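{- Let $d\ge2$ and suppose $A\subseteq\mathbb{Z}$ is $d$-automatic and not $d$-sparse. If $A$ is stable in $(\mathbb{Z},+)$, then $A$ is generic, i.e. some finite union of additive translates $c_1+A,\ldots,c_k+A$ covers $\mathbb{Z}$.
   Context: For a string $k_0\cdots k_n$ of integers, $[k_0\cdots k_n]=\sum_ik_id^i$. $\Sigma=\{0,\ldots,d-1\}$, $\Sigma_\pm=\{ -d+1,\ldots,d-1\}$. $A\subseteq\mathbb{Z}$ is $d$-automatic if $\{\sigma\in\Sigma_\pm^*:[\sigma]\in A\}$ is regular. The canonical representation of $0$ is the empty word, of $a>0$ its usual base-$d$ digit string in $\Sigma^*$ written least significant digit first, and of $a<0$ the word $(-k_0)\cdots(-k_n)$ where $k_0\cdots k_n$ is that of $-a$. A language is sparse if it is regular and the number of its words of length $\le k$ is bounded by a polynomial in $k$; $A$ is $d$-sparse if its set of canonical representations is sparse. $A$ is stable in $(\mathbb{Z},+)$ if there is $N$ such that there are no $a_0,\ldots,a_N,b_0,\ldots,b_N\in\mathbb{Z}$ with $a_i+b_j\in A\iff i\le j$. -}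

module Defs where

open import Level using (0ℓ)
open import Data.Bool using (Bool; true)
open import Data.Nat as ℕ using (ℕ; zero; suc; _∸_; _^_; NonZero)
open import Data.Nat.ListAction using (sum)
open import Data.Nat.DivMod using (_%_; _/_)
open import Data.Fin using (Fin; toℕ)
open import Data.Fin.Base using () renaming (_≤_ to _≤ᶠ_)
open import Data.Integer as ℤ using (ℤ; +_; -[1+_])
open import Data.List using (List; []; _∷_; foldl; foldr; map; concatMap; allFin; filterᵇ; length; upTo)
open import Data.List.Membership.Propositional using (_∈_)
open import Data.Product using (Σ; ∃; _×_; _,_)
open import Function using (_⇔_)
open import Relation.Nullary using (¬_)
open import Relation.Binary.PropositionalEquality using (_≡_)

-- The alphabet Σ_± = {-d+1,…,d-1} is encoded as Fin (d + (d ∸ 1))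
-- (which has 2d-1 elements); the letter with index i stands for the
-- digit  i - (d-1).

Σ± : ℕ → Set
Σ± d = Fin (d ℕ.+ (d ∸ 1))

digitVal : (d : ℕ) → Σ± d → ℤ
digitVal d i = + toℕ i ℤ.- + (d ∸ 1)

value : (d : ℕ) → List (Σ± d) → ℤ
value d = foldr (λ i acc → digitVal d i ℤ.+ (+ d) ℤ.* acc) (+ 0)

record DFA (m : ℕ) : Set where
  field
    nStates : ℕ
    start   : Fin nStates
    δ       : Fin nStates → Fin m → Fin nStates
    final   : Fin nStates → Bool

accepts : ∀ {m} → DFA m → List (Fin m) → Bool
accepts D w = DFA.final D (foldl (DFA.δ D) (DFA.start D) w)

Language : ℕ → Set₁
Language m = List (Fin m) → Set

Recognises : ∀ {m} → DFA m → Language m → Set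
Recognises D L = ∀ w → (L w ⇔ (accepts D w ≡ true))

Regular : ∀ {m} → Language m → Set
Regular {m} L = Σ (DFA m) λ D → Recognises D L

wordsOfLength : (m j : ℕ) → List (List (Fin m))
wordsOfLength m zero    = [] ∷ []
wordsOfLength m (suc j) = concatMap (λ w → map (_∷ w) (allFin m)) (wordsOfLength m j)

countUpTo : ∀ {m} → DFA m → ℕ → ℕ
countUpTo {m} D k = sum (map (λ j → length (filterᵇ (accepts D) (wordsOfLength m j))) (upTo (suc k)))

-- sparse: regular, and the number of words of length ≤ k is bounded by a
-- polynomial in k (w.l.o.g. of the form c·(k+1)^p)
Sparse : ∀ {m} → Language m → Set
Sparse {m} L = Σ (DFA m) λ D → Recognises D L ×
  (∃ λ c → ∃ λ p → ∀ k → countUpTo D k ℕ.≤ c ℕ.* (suc k) ^ p)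

Automatic : (d : ℕ) → (ℤ → Set) → Set
Automatic d A = Regular {d ℕ.+ (d ∸ 1)} (λ σ → A (value d σ))

-- Canonical representations.  Base-d digits of n, least significant
-- first (fuel n suffices for d ≥ 2).

module _ (d : ℕ) .{{_ : NonZero d}} where

  digitsF : ℕ → ℕ → List ℕ
  digitsF zero    n       = []
  digitsF (suc f) zero    = []
  digitsF (suc f) (suc n) = (suc n % d) ∷ digitsF f (suc n / d)

  baseDigits : ℕ → List ℕ
  baseDigits n = digitsF n n

  -- canonical representation of a, as the list of letter indices
  -- (digit k has index k + (d-1))
  canonIdx : ℤ → List ℕ
  canonIdx (+ n)      = map (λ r → (d ∸ 1) ℕ.+ r) (baseDigits n)
  canonIdx -[1+ n ]   = map (λ r → (d ∸ 1) ∸ r) (baseDigits (suc n))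

  CanonLang : (ℤ → Set) → Language (d ℕ.+ (d ∸ 1))
  CanonLang A σ = ∃ λ a → A a × (map toℕ σ ≡ canonIdx a)

  SparseSet : (ℤ → Set) → Set
  SparseSet A = Sparse (CanonLang A)

Stable : (ℤ → Set) → Set
Stable A = ∃ λ N → ∀ (a b : Fin (suc N) → ℤ) →
  ¬ (∀ i j → (A (a i ℤ.+ b j) ⇔ (i ≤ᶠ j)))

Generic : (ℤ → Set) → Set
Generic A = ∃ λ (cs : List ℤ) → ∀ z → ∃ λ c → (c ∈ cs) × A (z ℤ.- c)

{-# OPTIONS --safe #-}
module Submission where

-- Pumping.  A DFA in which no useful state has two different loops of equal length accepts only
-- polynomially many words of each length, since a word is then determined by the times and letters
-- of its last departures from the states.  As A is not sparse, a DFA for A has a state q, reached by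
-- u and accepting w, with two loops of equal length and different values.  Replacing the loops by
-- suitable words in them we get loops v₁, v₂ at q with v₁v₂ ~ v₂ and v₂v₂ ~ v₂, where ~ means equal
-- action on the states.
--
-- Progressions.  Let h = [v₂] - [v₁] and let σₖ be a word of length |v₁| and value [v₁] + k h.  If
-- u σₖ v₂ w is accepted and u σₖ₊₁ v₂ w is not, then adding k h at the i-th block of
-- u v₁ʲ⁺¹ v₂ᴺ⁻ʲ v₂ w creates σₖ among loops if i ≤ j, and σₖ₊₁ if i > j, and by the relations above this
-- contradicts stability.  Hence A contains arbitrarily long progressions of a fixed difference.
--
-- Genericity.  If A is not generic, its complement contains arbitrarily long intervals.  Choosing
-- alternately aₙ with all aₙ + bⱼ, j < n, in such an interval, and bₙ with all aᵢ + bₙ, i ≤ n, in such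
-- a progression, again contradicts stability.  Whether a gap of a given length exists is decidable by
-- searching the automaton, which makes the argument constructive.

open import Defs
open import Data.Nat using (ℕ; _≤_; NonZero)
open import Data.Integer using (ℤ)
open import Relation.Nullary using (¬_)
open import Data.Bool using (Bool; true; false; T; if_then_else_; _∧_; _∨_)
open import Data.Bool.ListAction using (all)
open import Data.Bool.Properties using (T-≡; T?; ∧-conicalˡ; ∧-conicalʳ; ∨-zeroʳ) renaming (_≟_ to _≟ᵇ_)
open import Data.Empty using (⊥)
open import Data.Fin as Fin using (Fin; zero; suc; toℕ; fromℕ<; combine; remQuot)
import Data.Fin.Properties as Fin
open import Data.Fin.Properties using (any?; all?; pigeonhole; injective⇒≤)
open import Data.Integer as ℤ using (+_; -[1+_]; ∣_∣)
import Data.Integer.Properties as ℤ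
open import Data.Integer.DivMod using (n%ℕd<d; a≡a%ℕn+[a/ℕn]*n; n%d<d; a≡a%n+[a/n]*n)
open import Data.Integer.Tactic.RingSolver using (solve-∀)
open import Data.List using (List; []; _∷_; _++_; foldl; map; concatMap; allFin; filterᵇ; length; lookup;
  upTo; take; drop; zip; cartesianProductWith)
open import Data.List.Membership.Propositional using (_∈_)
open import Data.List.Membership.Propositional.Properties using (∈-filter⁻; ∈-upTo⁻; ∈-upTo⁺; ∈-lookup;
  ∈-cartesianProductWith⁻; ∈-cartesianProductWith⁺)
open import Data.List.Properties using (foldl-++; length-++; length-take; length-drop; length-upTo;
  take++drop≡id; ∷-injective; ++-assoc; ++-identityʳ; ≡-dec)
open import Data.List.Relation.Unary.All using ([]; _∷_)
import Data.List.Relation.Unary.All as All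
open import Data.List.Relation.Unary.AllPairs using ([]; _∷_)
open import Data.List.Relation.Unary.Any using (here; there)
open import Data.List.Relation.Unary.Unique.Propositional using (Unique)
open import Data.List.Relation.Unary.Unique.Propositional.Properties using (cartesianProductWith⁺; allFin⁺; filter⁺)
open import Data.Maybe using (Maybe; just; nothing; _<∣>_)
open import Data.Nat as ℕ using (zero; suc; _<_; _∸_; _^_; _⊓_; _!; _<ᵇ_; s≤s; z≤n)
import Data.Nat.Properties as ℕ
open import Data.Nat.Divisibility using (_∣_; divides; ∣-trans; m≤n⇒m!∣n!; m∣m*n; n∣m*n)
open import Data.Nat.DivMod using (_%_; _/_; m%n<n; m<n⇒m%n≡m; m≡m%n+[m/n]*n; m/n<m; [m+kn]%n≡m%n; m*n/n≡m;
  +-distrib-/-∣ʳ; m<n⇒m/n≡0; m<n*o⇒m/o<n)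
open import Data.Nat.ListAction using (sum)
open import Data.Nat.Tactic.RingSolver using () renaming (solve-∀ to solveℕ-∀)
open import Data.Product using (∃; ∃₂; _×_; _,_; proj₁; proj₂; uncurry)
open import Data.Product.Properties using () renaming (≡-dec to ×-≡-dec)
open import Data.Sum using (_⊎_; inj₁; inj₂)
open import Data.Unit using (⊤; tt)
open import Data.Vec as Vec using (Vec; []; _∷_; tabulate)
import Data.Vec.Properties as Vec
open import Data.Vec.Functional using () renaming (_∷_ to _◂_)
open import Function using (_∘_; id; _⇔_; Equivalence; mk⇔)
open import Relation.Binary.Definitions using (Tri; tri<; tri≈; tri>)
open import Relation.Binary.PropositionalEquality using (_≡_; _≢_; refl; sym; trans; cong; cong₂; subst; module ≡-Reasoning)
open import Relation.Nullary using (Dec; yes; no; does; contradiction)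
open import Relation.Nullary.Decidable using (map′; _×-dec_; ¬?; decidable-stable; dec-true; dec-false)

open DFA

private
  variable
    m n : ℕ
    A : Set

-- Decidable reachability in finite transition systems

module Reachability {S Σₐ : Set} (step : S → Σₐ → S)
  (exists? : ∀ {P : Σₐ → Set} → (∀ a → Dec (P a)) → Dec (∃ P))
  (code : S → Fin n) (code-injective : ∀ {s t} → code s ≡ code t → s ≡ t) where

  -- Among the first `n + 1` prefixes two lead to states of equal code; cutting out the letters
  -- between them removes a loop.
  shorten-once : ∀ s w → n ≤ length w →
    ∃ λ v → length v < length w × foldl step s v ≡ foldl step s w
  shorten-once s w n≤∣w∣
    with pigeonhole (ℕ.n<1+n n) (λ i → code (foldl step s (take (toℕ i) w)))
  ... | i , j , i<j , same = take (toℕ i) w ++ drop (toℕ j) w , shorter , same-end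
    where
    j≤∣w∣ : toℕ j ≤ length w
    j≤∣w∣ = ℕ.≤-trans (ℕ.≤-pred (Fin.toℕ<n j)) n≤∣w∣

    shorter : length (take (toℕ i) w ++ drop (toℕ j) w) < length w
    shorter = begin-strict
      length (take (toℕ i) w ++ drop (toℕ j) w)    ≡⟨ length-++ (take (toℕ i) w) ⟩
      length (take (toℕ i) w) ℕ.+ length (drop (toℕ j) w)
        ≡⟨ cong₂ ℕ._+_ (length-take (toℕ i) w) (length-drop (toℕ j) w) ⟩
      toℕ i ⊓ length w ℕ.+ (length w ∸ toℕ j)      ≤⟨ ℕ.+-monoˡ-≤ _ (ℕ.m⊓n≤m (toℕ i) _) ⟩
      toℕ i ℕ.+ (length w ∸ toℕ j)                 <⟨ ℕ.+-monoˡ-< _ i<j ⟩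
      toℕ j ℕ.+ (length w ∸ toℕ j)                 ≡⟨ ℕ.m+[n∸m]≡n j≤∣w∣ ⟩
      length w                                     ∎
      where open ℕ.≤-Reasoning

    same-end : foldl step s (take (toℕ i) w ++ drop (toℕ j) w) ≡ foldl step s w
    same-end = begin
      foldl step s (take (toℕ i) w ++ drop (toℕ j) w)
        ≡⟨ foldl-++ step s (take (toℕ i) w) _ ⟩
      foldl step (foldl step s (take (toℕ i) w)) (drop (toℕ j) w)
        ≡⟨ cong (λ t → foldl step t (drop (toℕ j) w)) (code-injective same) ⟩
      foldl step (foldl step s (take (toℕ j) w)) (drop (toℕ j) w)
        ≡⟨ foldl-++ step s (take (toℕ j) w) _ ⟨
      foldl step s (take (toℕ j) w ++ drop (toℕ j) w)
        ≡⟨ cong (foldl step s) (take++drop≡id (toℕ j) w) ⟩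
      foldl step s w ∎
      where open ≡-Reasoning

  shorten : ∀ k s w → length w ≤ k → ∃ λ v → length v ≤ n × foldl step s v ≡ foldl step s w
  shorten k s w ∣w∣≤k with length w ℕ.≤? n
  ... | yes ∣w∣≤n = w , ∣w∣≤n , refl
  shorten zero s w ∣w∣≤0 | no ∣w∣≰n = contradiction (ℕ.≤-trans ∣w∣≤0 z≤n) ∣w∣≰n
  shorten (suc k) s w ∣w∣≤k | no ∣w∣≰n with shorten-once s w (ℕ.<⇒≤ (ℕ.≰⇒> ∣w∣≰n))
  ... | v , ∣v∣<∣w∣ , v≈w with shorten k s v (ℕ.≤-pred (ℕ.<-≤-trans ∣v∣<∣w∣ ∣w∣≤k))
  ... | u , ∣u∣≤n , u≈v = u , ∣u∣≤n , trans u≈v v≈w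

  module _ {P : S → Set} (P? : ∀ s → Dec (P s)) where

    reachWithin? : ∀ k s → Dec (∃ λ w → length w ≤ k × P (foldl step s w))
    reachWithin? k s with P? s
    ... | yes p = yes ([] , z≤n , p)
    reachWithin? zero s | no ¬p = no λ where ([] , _ , p) → ¬p p
    reachWithin? (suc k) s | no ¬p = map′
      (λ (a , w , ∣w∣≤k , p) → a ∷ w , s≤s ∣w∣≤k , p)
      (λ where
        ([] , _ , p) → contradiction p ¬p
        (a ∷ w , s≤s ∣w∣≤k , p) → a , w , ∣w∣≤k , p)
      (exists? λ a → reachWithin? k (step s a))

    -- Since loops can be cut out, words of length at most `n` decide the question. Letters and
    -- states are kept abstract because the search is also run on pairs of states, with pairs of
    -- letters, and on vectors of states.
    reach? : ∀ s → Dec (∃ λ w → P (foldl step s w))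
    reach? s = map′
      (λ (w , _ , p) → w , p)
      (λ (w , p) → let v , ∣v∣≤n , v≈w = shorten (length w) s w ℕ.≤-refl
                   in v , ∣v∣≤n , subst P (sym v≈w) p)
      (reachWithin? n s)

vecCode : Vec (Fin m) n → Fin (m ^ n)
vecCode []      = zero
vecCode (i ∷ v) = combine i (vecCode v)

vecCode-injective : (v w : Vec (Fin m) n) → vecCode v ≡ vecCode w → v ≡ w
vecCode-injective []      []      _  = refl
vecCode-injective (i ∷ v) (j ∷ w) eq =
  let i≡j , v≡w = Fin.combine-injective i (vecCode v) j (vecCode w) eq
  in cong₂ _∷_ i≡j (vecCode-injective v w v≡w)


-- Double loops and last departures

run : (D : DFA m) → Fin (nStates D) → List (Fin m) → Fin (nStates D)
run D = foldl (δ D)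

-- Loops that begin alike can be rotated until they begin with different letters. In this form the
-- loops have different values later, because digits come least significant first.
record DoubleLoop (D : DFA m) : Set where
  field
    q           : Fin (nStates D)
    a b         : Fin m
    u x y w     : List (Fin m)
    a≢b         : a ≢ b
    ∣x∣≡∣y∣     : length x ≡ length y
    u-reaches   : run D (start D) u ≡ q
    loop-a∷x    : run D q (a ∷ x) ≡ q
    loop-b∷y    : run D q (b ∷ y) ≡ q
    w-accepted  : final D (run D q w) ≡ true

module _ (D : DFA m) where

  private
    Q = Fin (nStates D)
    Pair = Fin m × Fin m

    step₂ : Q × Q → Pair → Q × Q
    step₂ (p , q) (a , b) = δ D p a , δ D q b

    run₂ : ∀ p q z → foldl step₂ (p , q) z ≡ (run D p (map proj₁ z) , run D q (map proj₂ z))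
    run₂ p q []            = refl
    run₂ p q ((a , b) ∷ z) = run₂ (δ D p a) (δ D q b) z

    run₂-zip : ∀ p q x y → length x ≡ length y →
      foldl step₂ (p , q) (zip x y) ≡ (run D p x , run D q y)
    run₂-zip p q []      []      _  = refl
    run₂-zip p q (a ∷ x) (b ∷ y) eq = run₂-zip (δ D p a) (δ D q b) x y (ℕ.suc-injective eq)

    existsPair? : ∀ {P : Pair → Set} → (∀ a → Dec (P a)) → Dec (∃ P)
    existsPair? P? = map′ (λ (a , b , p) → (a , b) , p) (λ ((a , b) , p) → a , b , p)
                          (any? λ a → any? λ b → P? (a , b))

    pairCode-injective : {p q : Q × Q} → uncurry combine p ≡ uncurry combine q → p ≡ q
    pairCode-injective {p , q} {p′ , q′} eq =
      let p≡p′ , q≡q′ = Fin.combine-injective p q p′ q′ eq in cong₂ _,_ p≡p′ q≡q′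

    module One = Reachability (δ D) any? id id
    module Two = Reachability step₂ existsPair? (uncurry combine) pairCode-injective

    length-projections : (z : List Pair) → length (map proj₁ z) ≡ length (map proj₂ z)
    length-projections []      = refl
    length-projections (_ ∷ z) = cong suc (length-projections z)

  -- Two loops of equal length at `q` are one path in the square of the automaton, from the pair of
  -- first successors back to `(q , q)`, so reachability there decides their existence. Decidability
  -- is what extracts an actual double loop from the mere failure of sparseness.
  doubleLoop? : Dec (DoubleLoop D)
  doubleLoop? = map′
    (λ (q , a , b , a≢b , (u , →q) , (w , acc) , (z , loops)) →
      let both = trans (sym (run₂ (δ D q a) (δ D q b) z)) loops in
      record { q = q ; a = a ; b = b ; u = u ; w = w ; x = map proj₁ z ; y = map proj₂ z
             ; a≢b = a≢b ; ∣x∣≡∣y∣ = length-projections z ; u-reaches = →q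
             ; loop-a∷x = cong proj₁ both ; loop-b∷y = cong proj₂ both ; w-accepted = acc })
    (λ L → let open DoubleLoop L in
      q , a , b , a≢b , (u , u-reaches) , (w , w-accepted) ,
      (zip x y , trans (run₂-zip _ _ x y ∣x∣≡∣y∣) (cong₂ _,_ loop-a∷x loop-b∷y)))
    (any? λ q → any? λ a → any? λ b →
      ¬? (a Fin.≟ b) ×-dec
      One.reach? (Fin._≟ q) (start D) ×-dec
      One.reach? (λ p → final D p ≟ᵇ true) q ×-dec
      Two.reach? (λ p → ×-≡-dec Fin._≟_ Fin._≟_ p (q , q)) (δ D q a , δ D q b))

  -- Times are counted from the end of the word, so that adding a prefix does not change them.
  lastDeparture : Q → List (Fin m) → Q → Maybe (ℕ × Fin m)
  lastDeparture q []      s = nothing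
  lastDeparture q (a ∷ w) s =
    lastDeparture (δ D q a) w s <∣> (if does (q Fin.≟ s) then just (length w , a) else nothing)

  lastDeparture-++ : ∀ q p z {s r} →
    lastDeparture (run D q p) z s ≡ just r → lastDeparture q (p ++ z) s ≡ just r
  lastDeparture-++ q []      z eq = eq
  lastDeparture-++ q (a ∷ p) z eq rewrite lastDeparture-++ (δ D q a) p z eq = refl

  lastDeparture-self : ∀ q a w → ∃ λ r → lastDeparture q (a ∷ w) q ≡ just r
  lastDeparture-self q a w with lastDeparture (δ D q a) w q
  ... | just r = r , refl
  ... | nothing with q Fin.≟ q
  ...   | yes _   = _ , refl
  ...   | no q≢q = contradiction refl q≢q

  lastDeparture-split : ∀ q w {s l c} → lastDeparture q w s ≡ just (l , c) →
    ∃₂ λ x z → w ≡ x ++ c ∷ z × run D q x ≡ s × length z ≡ l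
  lastDeparture-split q (a ∷ w) {s} eq
    with lastDeparture (δ D q a) w s in eq′
  lastDeparture-split q (a ∷ w) refl | just _
    with x , z , w≡ , →s , ∣z∣ ← lastDeparture-split (δ D q a) w eq′
    = a ∷ x , z , cong (a ∷_) w≡ , →s , ∣z∣
  lastDeparture-split q (a ∷ w) {s} eq | nothing with q Fin.≟ s
  lastDeparture-split q (a ∷ w) refl | nothing | yes q≡s = [] , w , refl , q≡s , refl

  firstDifference : (v w : List (Fin m)) → length v ≡ length w → v ≢ w →
    ∃ λ p → ∃₂ λ a b → ∃₂ λ x y →
      v ≡ p ++ a ∷ x × w ≡ p ++ b ∷ y × a ≢ b × length x ≡ length y
  firstDifference []      []      _  v≢w = contradiction refl v≢w
  firstDifference (a ∷ v) (b ∷ w) eq v≢w with a Fin.≟ b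
  ... | no a≢b = [] , a , b , v , w , refl , refl , a≢b , ℕ.suc-injective eq
  ... | yes refl
    with p , a′ , b′ , x , y , v≡ , w≡ , a≢b , ∣x∣≡∣y∣
      ← firstDifference v w (ℕ.suc-injective eq) (v≢w ∘ cong (a ∷_))
    = a ∷ p , a′ , b′ , x , y , cong (a ∷_) v≡ , cong (a ∷_) w≡ , a≢b , ∣x∣≡∣y∣

  -- The words part at some state q and depart from it for the last time
  -- simultaneously and by the same letter, so that in between they loop
  -- at q in different ways.
  sameDepartures⇒doubleLoop : ∀ v w → length v ≡ length w → accepts D v ≡ true → v ≢ w →
    (∀ s → lastDeparture (start D) v s ≡ lastDeparture (start D) w s) → DoubleLoop D
  sameDepartures⇒doubleLoop v w ∣v∣≡∣w∣ accepted v≢w same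
    with p , a , b , x , y , refl , refl , a≢b , ∣x∣≡∣y∣ ← firstDifference v w ∣v∣≡∣w∣ v≢w
    with (l , c) , departs-v ← lastDeparture-self (run D (start D) p) a x
    with lastDeparture-self (run D (start D) p) b y
  ... | r , departs-w
    with refl ← trans (sym (lastDeparture-++ (start D) p (a ∷ x) departs-v))
                  (trans (same _) (lastDeparture-++ (start D) p (b ∷ y) departs-w))
    with lastDeparture-split _ (a ∷ x) departs-v | lastDeparture-split _ (b ∷ y) departs-w
  -- An empty part before `c` makes the departure at the first difference the last one. For both
  -- words this forces `a` and `b` to equal `c`; for only one of them it gives remainders of
  -- different lengths, although both have length `l`.
  ... | [] , _ , refl , _ , _ | [] , _ , refl , _ , _ = contradiction refl a≢b
  ... | [] , _ , refl , _ , refl | _ ∷ y′ , z , refl , _ , ∣z∣ =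
    contradiction (trans ∣x∣≡∣y∣ (trans (length-++ y′) (ℕ.+-suc _ _)))
      (ℕ.<⇒≢ (s≤s (ℕ.≤-trans (ℕ.≤-reflexive (sym ∣z∣)) (ℕ.m≤n+m _ (length y′)))))
  ... | _ ∷ x′ , z , refl , _ , ∣z∣ | [] , _ , refl , _ , refl =
    contradiction (trans (sym ∣x∣≡∣y∣) (trans (length-++ x′) (ℕ.+-suc _ _)))
      (ℕ.<⇒≢ (s≤s (ℕ.≤-trans (ℕ.≤-reflexive (sym ∣z∣)) (ℕ.m≤n+m _ (length x′)))))
  ... | _ ∷ x′ , z , refl , loop-x , ∣z∣ | _ ∷ y′ , z′ , refl , loop-y , ∣z′∣ = record
    { q = run D (start D) p ; a = a ; b = b ; u = p ; x = x′ ; y = y′ ; w = a ∷ x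
    ; a≢b = a≢b
    ; ∣x∣≡∣y∣ = ℕ.+-cancelʳ-≡ (suc l) (length x′) (length y′) (begin
        length x′ ℕ.+ suc l         ≡⟨ cong (λ k → length x′ ℕ.+ suc k) ∣z∣ ⟨
        length x′ ℕ.+ suc (length z) ≡⟨ length-++ x′ ⟨
        length (x′ ++ c ∷ z)        ≡⟨ ∣x∣≡∣y∣ ⟩
        length (y′ ++ c ∷ z′)       ≡⟨ length-++ y′ ⟩
        length y′ ℕ.+ suc (length z′) ≡⟨ cong (λ k → length y′ ℕ.+ suc k) ∣z′∣ ⟩
        length y′ ℕ.+ suc l         ∎)
    ; u-reaches = refl
    ; loop-a∷x = loop-x
    ; loop-b∷y = loop-y
    ; w-accepted = trans (cong (final D) (sym (foldl-++ (δ D) (start D) p (a ∷ x)))) accepted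
    }
    where open ≡-Reasoning

  -- `zero` stands for no departure. It is also the default for a time out of range, which does not
  -- occur for words of length `j`.
  departureCode : ∀ j → Maybe (ℕ × Fin m) → Fin (suc (j ℕ.* m))
  departureCode j nothing        = zero
  departureCode j (just (l , c)) with l ℕ.<? j
  ... | yes l<j = suc (combine (fromℕ< l<j) c)
  ... | no _    = zero

  lastDeparture-bounded : ∀ q w {s l c} → lastDeparture q w s ≡ just (l , c) → l < length w
  lastDeparture-bounded q w eq with x , z , refl , _ , refl ← lastDeparture-split q w eq =
    ℕ.≤-trans (ℕ.m≤n+m _ (length x)) (ℕ.≤-reflexive (sym (length-++ x)))

  departureCode-injective : ∀ j {d e} →
    (∀ {l c} → d ≡ just (l , c) → l < j) → (∀ {l c} → e ≡ just (l , c) → l < j) →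
    departureCode j d ≡ departureCode j e → d ≡ e
  departureCode-injective j {nothing} {nothing} _ _ _ = refl
  departureCode-injective j {nothing} {just (l , c)} _ e< eq with l ℕ.<? j
  departureCode-injective j {nothing} {just (l , c)} _ e< () | yes _
  ... | no l≮j = contradiction (e< refl) l≮j
  departureCode-injective j {just (l , c)} {nothing} d< _ eq with l ℕ.<? j
  departureCode-injective j {just (l , c)} {nothing} d< _ () | yes _
  ... | no l≮j = contradiction (d< refl) l≮j
  departureCode-injective j {just (l , c)} {just (l′ , c′)} d< e< eq with l ℕ.<? j | l′ ℕ.<? j
  ... | no l≮j  | _        = contradiction (d< refl) l≮j
  ... | yes _   | no l′≮j  = contradiction (e< refl) l′≮j
  ... | yes l<j | yes l′<j =
    let l≡ , c≡ = Fin.combine-injective (fromℕ< l<j) c (fromℕ< l′<j) c′ (Fin.suc-injective eq)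
    in cong₂ (λ k b → just (k , b)) (Fin.fromℕ<-injective l l′ l<j l′<j l≡) c≡

-- Counting accepted words

wordsOfLength-suc : ∀ m j → wordsOfLength m (suc j) ≡
  cartesianProductWith (λ w a → a ∷ w) (wordsOfLength m j) (allFin m)
wordsOfLength-suc m j = go (wordsOfLength m j)
  where
  go : ∀ ws → concatMap (λ w → map (_∷ w) (allFin m)) ws ≡
              cartesianProductWith (λ w a → a ∷ w) ws (allFin m)
  go []       = refl
  go (w ∷ ws) = cong (map (_∷ w) (allFin m) ++_) (go ws)

wordsOfLength-unique : ∀ m j → Unique (wordsOfLength m j)
wordsOfLength-unique m zero    = [] ∷ []
wordsOfLength-unique m (suc j) rewrite wordsOfLength-suc m j =
  cartesianProductWith⁺ _ (λ eq → proj₂ (∷-injective eq) , proj₁ (∷-injective eq))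
    (wordsOfLength-unique m j) (allFin⁺ m)

∈-wordsOfLength⁻ : ∀ m j {w} → w ∈ wordsOfLength m j → length w ≡ j
∈-wordsOfLength⁻ m zero    (here refl) = refl
∈-wordsOfLength⁻ m (suc j) w∈ rewrite wordsOfLength-suc m j
  with v , a , v∈ , _ , refl ← ∈-cartesianProductWith⁻ _ (wordsOfLength m j) (allFin m) w∈
  = cong suc (∈-wordsOfLength⁻ m j v∈)

lookup-injective : {xs : List A} → Unique xs → ∀ i j → lookup xs i ≡ lookup xs j → i ≡ j
lookup-injective (_  ∷ _) zero    zero    _  = refl
lookup-injective (x∉ ∷ _) zero    (suc j) eq = contradiction eq (All.lookup x∉ (∈-lookup j))
lookup-injective (x∉ ∷ _) (suc i) zero    eq = contradiction (sym eq) (All.lookup x∉ (∈-lookup i))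
lookup-injective (_  ∷ u) (suc i) (suc j) eq = cong suc (lookup-injective u i j eq)

^-distribʳ-* : ∀ n a b → (a ℕ.* b) ^ n ≡ a ^ n ℕ.* b ^ n
^-distribʳ-* zero    a b = refl
^-distribʳ-* (suc n) a b = trans (cong (a ℕ.* b ℕ.*_) (^-distribʳ-* n a b))
                                 (ℕ.[m*n]*[o*p]≡[m*o]*[n*p] a b (a ^ n) (b ^ n))

sum-map-≤ : ∀ (f : A → ℕ) xs {b} → (∀ {x} → x ∈ xs → f x ≤ b) → sum (map f xs) ≤ length xs ℕ.* b
sum-map-≤ f []       _ = z≤n
sum-map-≤ f (x ∷ xs) f≤ = ℕ.+-mono-≤ (f≤ (here refl)) (sum-map-≤ f xs (f≤ ∘ there))

module _ (D : DFA m) (¬loop : ¬ DoubleLoop D) where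

  private N = nStates D

  -- Without a double loop an accepted word of length `j` is determined by its last departures, one
  -- for each of the `N` states. Each is absent or consists of one of `j` times and one of `m`
  -- letters, which leaves `suc (j * m)` possibilities.
  acceptedOfLength-≤ : ∀ j → length (filterᵇ (accepts D) (wordsOfLength m j)) ≤ suc (j ℕ.* m) ^ N
  acceptedOfLength-≤ j = injective⇒≤ {f = code ∘ lookup accepted} λ {i} {k} eq →
    lookup-injective unique i k
      (code-injective (member (∈-lookup i)) (member (∈-lookup k)) eq)
    where
    accepted = filterᵇ (accepts D) (wordsOfLength m j)

    unique : Unique accepted
    unique = filter⁺ (T? ∘ accepts D) (wordsOfLength-unique m j)

    member : ∀ {w} → w ∈ accepted → length w ≡ j × accepts D w ≡ true
    member w∈ with w∈words , acc ← ∈-filter⁻ (T? ∘ accepts D) w∈ =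
      ∈-wordsOfLength⁻ m j w∈words , Equivalence.to T-≡ acc

    departures : List (Fin m) → Fin N → Fin (suc (j ℕ.* m))
    departures w s = departureCode D j (lastDeparture D (start D) w s)

    code : List (Fin m) → Fin (suc (j ℕ.* m) ^ N)
    code w = vecCode (tabulate (departures w))

    code-injective : ∀ {v w} → length v ≡ j × accepts D v ≡ true →
      length w ≡ j × accepts D w ≡ true → code v ≡ code w → v ≡ w
    code-injective {v} {w} (refl , acc) (∣w∣≡ , _) eq =
      -- The absence of double loops only refutes `v ≢ w`; equality of words is decidable.
      decidable-stable (≡-dec Fin._≟_ v w) λ v≢w →
        ¬loop (sameDepartures⇒doubleLoop D v w (sym ∣w∣≡) acc v≢w λ s →
          departureCode-injective D j (lastDeparture-bounded D _ v)
            (λ e → ℕ.<-≤-trans (lastDeparture-bounded D _ w e) (ℕ.≤-reflexive ∣w∣≡))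
            (same s))
      where
      same : ∀ s → departures v s ≡ departures w s
      same s = begin
        departures v s                          ≡⟨ Vec.lookup∘tabulate _ s ⟨
        Vec.lookup (tabulate (departures v)) s  ≡⟨ cong (λ t → Vec.lookup t s)
                                                     (vecCode-injective (tabulate (departures v)) (tabulate (departures w)) eq) ⟩
        Vec.lookup (tabulate (departures w)) s  ≡⟨ Vec.lookup∘tabulate _ s ⟩
        departures w s                          ∎
        where open ≡-Reasoning

  -- Each of the `suc k` lengths contributes at most `(suc m * suc k) ^ N`, whence the exponent
  -- `suc N` and a constant free of `k`.
  countUpTo-≤ : ∀ k → countUpTo D k ≤ suc m ^ N ℕ.* suc k ^ suc N
  countUpTo-≤ k = begin
    countUpTo D k                             ≤⟨ sum-map-≤ _ (upTo (suc k)) bound ⟩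
    length (upTo (suc k)) ℕ.* (suc m ℕ.* suc k) ^ N  ≡⟨ cong₂ ℕ._*_ (length-upTo (suc k)) (^-distribʳ-* N (suc m) (suc k)) ⟩
    suc k ℕ.* (suc m ^ N ℕ.* suc k ^ N)       ≡⟨ ℕ.*-assoc (suc k) (suc m ^ N) (suc k ^ N) ⟨
    suc k ℕ.* suc m ^ N ℕ.* suc k ^ N         ≡⟨ cong (ℕ._* suc k ^ N) (ℕ.*-comm (suc k) (suc m ^ N)) ⟩
    suc m ^ N ℕ.* suc k ℕ.* suc k ^ N         ≡⟨ ℕ.*-assoc (suc m ^ N) (suc k) (suc k ^ N) ⟩
    suc m ^ N ℕ.* suc k ^ suc N               ∎
    where
    open ℕ.≤-Reasoning

    bound : ∀ {j} → j ∈ upTo (suc k) →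
      length (filterᵇ (accepts D) (wordsOfLength m j)) ≤ (suc m ℕ.* suc k) ^ N
    bound {j} j∈ = begin
      length (filterᵇ (accepts D) (wordsOfLength m j)) ≤⟨ acceptedOfLength-≤ j ⟩
      suc (j ℕ.* m) ^ N      ≤⟨ ℕ.^-monoˡ-≤ N (begin
        suc (j ℕ.* m)          ≤⟨ s≤s (ℕ.*-monoˡ-≤ m (ℕ.≤-pred (∈-upTo⁻ j∈))) ⟩
        suc (k ℕ.* m)          ≤⟨ s≤s (ℕ.≤-trans (ℕ.*-monoʳ-≤ k (ℕ.n≤1+n m)) (ℕ.m≤n+m _ m)) ⟩
        suc m ℕ.+ k ℕ.* suc m  ≡⟨ ℕ.*-comm (suc k) (suc m) ⟩
        suc m ℕ.* suc k        ∎) ⟩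
      (suc m ℕ.* suc k) ^ N  ∎

¬sparse⇒doubleLoop : {L : Language m} (D : DFA m) → Recognises D L → ¬ Sparse L → DoubleLoop D
¬sparse⇒doubleLoop {m = m} D recognises ¬sparse = decidable-stable (doubleLoop? D) λ ¬loop →
  ¬sparse (D , recognises , suc m ^ nStates D , suc (nStates D) , countUpTo-≤ D ¬loop)

-- Products of automata and simple conditions on letters

module _ (_⊙_ : Bool → Bool → Bool) (D E : DFA m) where

  product : DFA m
  product .nStates   = nStates D ℕ.* nStates E
  product .start     = combine (start D) (start E)
  product .δ r a     = let p , q = remQuot (nStates E) r in combine (δ D p a) (δ E q a)
  product .final r   = let p , q = remQuot {nStates D} (nStates E) r in final D p ⊙ final E q

  run-product : ∀ p q w → run product (combine p q) w ≡ combine (run D p w) (run E q w)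
  run-product p q []      = refl
  run-product p q (a ∷ w) = trans
    (cong (λ (p , q) → run product (combine (δ D p a) (δ E q a)) w) (Fin.remQuot-combine p q))
    (run-product (δ D p a) (δ E q a) w)

  accepts-product : ∀ w → accepts product w ≡ (accepts D w ⊙ accepts E w)
  accepts-product w = begin
    final product (run product (start product) w)
      ≡⟨ cong (final product) (run-product (start D) (start E) w) ⟩
    final product (combine (run D (start D) w) (run E (start E) w))
      ≡⟨ cong (λ (p , q) → final D p ⊙ final E q) (Fin.remQuot-combine (run D (start D) w) (run E (start E) w)) ⟩
    accepts D w ⊙ accepts E w ∎
    where open ≡-Reasoning

isZero : Fin 2 → Bool
isZero zero    = true
isZero (suc _) = false

fromBool : Bool → Fin 2
fromBool true  = zero
fromBool false = suc zero

allDFA : (Fin m → Bool) → DFA m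
allDFA p = record
  { nStates = 2 ; start = zero ; final = isZero
  ; δ = λ { zero a → fromBool (p a) ; (suc _) _ → suc zero } }

accepts-allDFA : (p : Fin m → Bool) → ∀ w → accepts (allDFA p) w ≡ all p w
accepts-allDFA p = good
  where
  bad : ∀ w → isZero (run (allDFA p) (suc zero) w) ≡ false
  bad []      = refl
  bad (_ ∷ w) = bad w

  good : ∀ w → isZero (run (allDFA p) zero w) ≡ all p w
  good []      = refl
  good (a ∷ w) with p a
  ... | true  = good w
  ... | false = bad w

lastOrEmpty : (A → Bool) → List A → Bool
lastOrEmpty p []          = true
lastOrEmpty p (a ∷ [])    = p a
lastOrEmpty p (_ ∷ b ∷ w) = lastOrEmpty p (b ∷ w)

-- The start state is the accepting one, so that the empty word, which represents 0, passes;
-- afterwards the state remembers only the last letter.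
lastDFA : (Fin m → Bool) → DFA m
lastDFA p = record { nStates = 2 ; start = zero ; final = isZero ; δ = λ _ a → fromBool (p a) }

accepts-lastDFA : (p : Fin m → Bool) → ∀ w → accepts (lastDFA p) w ≡ lastOrEmpty p w
accepts-lastDFA p []      = refl
accepts-lastDFA p (a ∷ w) = from-any zero a w
  where
  from-any : ∀ s a w → isZero (run (lastDFA p) s (a ∷ w)) ≡ lastOrEmpty p (a ∷ w)
  from-any s a [] with p a
  ... | true  = refl
  ... | false = refl
  from-any s a (b ∷ w) = from-any (fromBool (p a)) b w

all-++⁻ : (p : A → Bool) → ∀ v w → all p (v ++ w) ≡ true → all p v ≡ true × all p w ≡ true
all-++⁻ p []      w eq = refl , eq
all-++⁻ p (a ∷ v) w eq with p a
all-++⁻ p (a ∷ v) w eq | true = all-++⁻ p v w eq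

-- Words in base `d` and their values

module Base (e : ℕ) where

  d : ℕ
  d = suc e

  Letter : Set
  Letter = Fin (d ℕ.+ e)

  Word : Set
  Word = List Letter

  pos-d^suc : ∀ n → + (d ^ suc n) ≡ + d ℤ.* + (d ^ n)
  pos-d^suc n = ℤ.pos-* d (d ^ n)

  value-++ : ∀ u v → value d (u ++ v) ≡ value d u ℤ.+ + (d ^ length u) ℤ.* value d v
  value-++ []      v = sym (trans (ℤ.+-identityˡ _) (ℤ.*-identityˡ _))
  value-++ (i ∷ u) v = begin
    digitVal d i ℤ.+ + d ℤ.* value d (u ++ v)
      ≡⟨ cong (λ t → digitVal d i ℤ.+ + d ℤ.* t) (value-++ u v) ⟩
    digitVal d i ℤ.+ + d ℤ.* (value d u ℤ.+ + (d ^ length u) ℤ.* value d v)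
      ≡⟨ rearrange (digitVal d i) (+ d) (value d u) (+ (d ^ length u)) (value d v) ⟩
    value d (i ∷ u) ℤ.+ (+ d ℤ.* + (d ^ length u)) ℤ.* value d v
      ≡⟨ cong (λ t → value d (i ∷ u) ℤ.+ t ℤ.* value d v) (pos-d^suc (length u)) ⟨
    value d (i ∷ u) ℤ.+ + (d ^ length (i ∷ u)) ℤ.* value d v ∎
    where
    open ≡-Reasoning
    rearrange : ∀ i d u p v → i ℤ.+ d ℤ.* (u ℤ.+ p ℤ.* v) ≡ (i ℤ.+ d ℤ.* u) ℤ.+ (d ℤ.* p) ℤ.* v
    rearrange = solve-∀

  magnitude : Letter → ℕ
  magnitude i = ∣ digitVal d i ∣

  digitVal-⊖ : ∀ i → digitVal d i ≡ toℕ i ℤ.⊖ e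
  digitVal-⊖ i = ℤ.m-n≡m⊖n (toℕ i) e

  -- A sign common to all digits of a word: `index r` is the letter of the digit `ε * r`. It lets
  -- words of nonnegative and of nonpositive digits share all arguments. The letter of the digit 0
  -- belongs to both orientations.
  record Orientation : Set where
    field
      ε         : ℤ
      ∣ε∣≡1     : ∣ ε ∣ ≡ 1
      index     : ℕ → ℕ
      index<    : ∀ {r} → r ≤ e → index r < d ℕ.+ e
      digit     : ∀ i {r} → r ≤ e → toℕ i ≡ index r → digitVal d i ≡ ε ℤ.* + r
      oriented  : Letter → Bool
      oriented⁺ : ∀ i {r} → toℕ i ≡ index r → oriented i ≡ true
      oriented⁻ : ∀ i → oriented i ≡ true → ∃ λ r → r ≤ e × toℕ i ≡ index r

  magnitude-unique : ∀ o i {r} → r ≤ e → toℕ i ≡ Orientation.index o r → magnitude i ≡ r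
  magnitude-unique o i {r} r≤e eq = begin
    ∣ digitVal d i ∣  ≡⟨ cong ∣_∣ (digit i r≤e eq) ⟩
    ∣ ε ℤ.* + r ∣     ≡⟨ ℤ.abs-* ε (+ r) ⟩
    ∣ ε ∣ ℕ.* r       ≡⟨ cong (ℕ._* r) ∣ε∣≡1 ⟩
    1 ℕ.* r           ≡⟨ ℕ.*-identityˡ r ⟩
    r                 ∎
    where
    open Orientation o
    open ≡-Reasoning

  nonnegative : Orientation
  nonnegative = record
    { ε = + 1 ; ∣ε∣≡1 = refl ; index = e ℕ.+_
    ; index< = λ r≤e → s≤s (ℕ.+-monoʳ-≤ e r≤e)
    ; digit = λ i {r} _ eq → begin
        digitVal d i           ≡⟨ digitVal-⊖ i ⟩
        toℕ i ℤ.⊖ e            ≡⟨ cong (ℤ._⊖ e) eq ⟩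
        (e ℕ.+ r) ℤ.⊖ e        ≡⟨ ℤ.⊖-≥ (ℕ.m≤m+n e r) ⟩
        + (e ℕ.+ r ∸ e)        ≡⟨ cong +_ (ℕ.m+n∸m≡n e r) ⟩
        + r                    ≡⟨ ℤ.*-identityˡ (+ r) ⟨
        + 1 ℤ.* + r            ∎
    ; oriented = λ i → does (e ℕ.≤? toℕ i)
    ; oriented⁺ = λ i {r} eq → dec-true (e ℕ.≤? toℕ i) (subst (e ≤_) (sym eq) (ℕ.m≤m+n e r))
    ; oriented⁻ = λ i ok → case-oriented i ok (e ℕ.≤? toℕ i)
    }
    where
    open ≡-Reasoning
    case-oriented : ∀ i (ok : does (e ℕ.≤? toℕ i) ≡ true) → Dec (e ≤ toℕ i) → ∃ λ r → r ≤ e × toℕ i ≡ e ℕ.+ r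
    case-oriented i ok (yes e≤i) = toℕ i ∸ e
      , ℕ.m≤n+o⇒m∸n≤o (toℕ i) e (ℕ.≤-pred (Fin.toℕ<n i)) , sym (ℕ.m+[n∸m]≡n e≤i)
    case-oriented i ok (no e≰i) = contradiction (trans (sym ok) (dec-false (e ℕ.≤? toℕ i) e≰i)) λ ()

  nonpositive : Orientation
  nonpositive = record
    { ε = ℤ.-1ℤ ; ∣ε∣≡1 = refl ; index = e ∸_
    ; index< = λ {r} _ → s≤s (ℕ.≤-trans (ℕ.m∸n≤m e r) (ℕ.m≤m+n e e))
    ; digit = λ i {r} r≤e eq → begin
        digitVal d i           ≡⟨ digitVal-⊖ i ⟩
        toℕ i ℤ.⊖ e            ≡⟨ cong (ℤ._⊖ e) eq ⟩
        (e ∸ r) ℤ.⊖ e          ≡⟨ ℤ.⊖-≤ (ℕ.m∸n≤m e r) ⟩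
        ℤ.- (+ (e ∸ (e ∸ r)))  ≡⟨ cong (λ t → ℤ.- (+ t)) (ℕ.m∸[m∸n]≡n r≤e) ⟩
        ℤ.- (+ r)              ≡⟨ ℤ.-1*i≡-i (+ r) ⟨
        ℤ.-1ℤ ℤ.* + r          ∎
    ; oriented = λ i → does (toℕ i ℕ.≤? e)
    ; oriented⁺ = λ i {r} eq → dec-true (toℕ i ℕ.≤? e) (subst (_≤ e) (sym eq) (ℕ.m∸n≤m e r))
    ; oriented⁻ = λ i ok → case-oriented i ok (toℕ i ℕ.≤? e)
    }
    where
    open ≡-Reasoning
    case-oriented : ∀ i (ok : does (toℕ i ℕ.≤? e) ≡ true) → Dec (toℕ i ≤ e) → ∃ λ r → r ≤ e × toℕ i ≡ e ∸ r
    case-oriented i ok (yes i≤e) = e ∸ toℕ i , ℕ.m∸n≤m e (toℕ i) , sym (ℕ.m∸[m∸n]≡n i≤e)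
    case-oriented i ok (no i≰e) = contradiction (trans (sym ok) (dec-false (toℕ i ℕ.≤? e) i≰e)) λ ()

  magnitude≤e : ∀ i → magnitude i ≤ e
  magnitude≤e i with ℕ.≤-total e (toℕ i)
  ... | inj₁ e≤i = subst (_≤ e) (sym (trans (cong ∣_∣ (digitVal-⊖ i)) (cong ∣_∣ (ℤ.⊖-≥ e≤i))))
                     (ℕ.m≤n+o⇒m∸n≤o (toℕ i) e (ℕ.≤-pred (Fin.toℕ<n i)))
  ... | inj₂ i≤e = subst (_≤ e) (sym (trans (cong ∣_∣ (trans (digitVal-⊖ i) (ℤ.⊖-≤ i≤e))) (ℤ.∣-i∣≡∣i∣ (+ (e ∸ toℕ i)))))
                     (ℕ.m∸n≤m e (toℕ i))

  d*-bound : ∀ {r a b} → r ≤ e → a < b → r ℕ.+ d ℕ.* a < d ℕ.* b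
  d*-bound {r} {a} {b} r≤e a<b = begin-strict
    r ℕ.+ d ℕ.* a  <⟨ ℕ.+-monoˡ-< (d ℕ.* a) (s≤s r≤e) ⟩
    d ℕ.+ d ℕ.* a  ≡⟨ ℕ.*-suc d a ⟨
    d ℕ.* suc a    ≤⟨ ℕ.*-monoʳ-≤ d a<b ⟩
    d ℕ.* b        ∎
    where open ℕ.≤-Reasoning

  ∣value∣<d^length : ∀ w → ∣ value d w ∣ < d ^ length w
  ∣value∣<d^length []      = s≤s z≤n
  ∣value∣<d^length (i ∷ w) = begin-strict
    ∣ digitVal d i ℤ.+ + d ℤ.* value d w ∣    ≤⟨ ℤ.∣i+j∣≤∣i∣+∣j∣ (digitVal d i) _ ⟩
    magnitude i ℕ.+ ∣ + d ℤ.* value d w ∣     ≡⟨ cong (magnitude i ℕ.+_) (ℤ.abs-* (+ d) (value d w)) ⟩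
    magnitude i ℕ.+ d ℕ.* ∣ value d w ∣       <⟨ d*-bound (magnitude≤e i) (∣value∣<d^length w) ⟩
    d ℕ.* d ^ length w                        ∎
    where open ℕ.≤-Reasoning

  ε-distrib : ∀ ε r n → ε ℤ.* + r ℤ.+ + d ℤ.* (ε ℤ.* + n) ≡ ε ℤ.* + (r ℕ.+ d ℕ.* n)
  ε-distrib ε r n = begin
    ε ℤ.* + r ℤ.+ + d ℤ.* (ε ℤ.* + n)  ≡⟨ rearrange ε (+ r) (+ d) (+ n) ⟩
    ε ℤ.* (+ r ℤ.+ + d ℤ.* + n)        ≡⟨ cong (λ t → ε ℤ.* (+ r ℤ.+ t)) (ℤ.pos-* d n) ⟨
    ε ℤ.* + (r ℕ.+ d ℕ.* n)            ∎
    where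
    open ≡-Reasoning
    rearrange : ∀ ε r d n → ε ℤ.* r ℤ.+ d ℤ.* (ε ℤ.* n) ≡ ε ℤ.* (r ℤ.+ d ℤ.* n)
    rearrange = solve-∀

  module _ (o : Orientation) where
    open Orientation o

    representMagnitude : ∀ L n → n < d ^ L → ∃ λ w → length w ≡ L × value d w ≡ ε ℤ.* + n
    representMagnitude zero zero _ = [] , refl , sym (ℤ.*-zeroʳ ε)
    representMagnitude zero (suc n) (s≤s ())
    representMagnitude (suc L) n n<d^L
      with w , ∣w∣ , w≡ ← representMagnitude L (n / d) (m<n*o⇒m/o<n (subst (n <_) (ℕ.*-comm d (d ^ L)) n<d^L))
      = i ∷ w , cong suc ∣w∣ , (begin
        digitVal d i ℤ.+ + d ℤ.* value d w
          ≡⟨ cong₂ (λ s t → s ℤ.+ + d ℤ.* t) (digit i r≤e (Fin.toℕ-fromℕ< (index< r≤e))) w≡ ⟩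
        ε ℤ.* + (n % d) ℤ.+ + d ℤ.* (ε ℤ.* + (n / d))   ≡⟨ ε-distrib ε (n % d) (n / d) ⟩
        ε ℤ.* + (n % d ℕ.+ d ℕ.* (n / d))               ≡⟨ cong (λ t → ε ℤ.* + (n % d ℕ.+ t)) (ℕ.*-comm d (n / d)) ⟩
        ε ℤ.* + (n % d ℕ.+ n / d ℕ.* d)                 ≡⟨ cong (λ t → ε ℤ.* + t) (m≡m%n+[m/n]*n n d) ⟨
        ε ℤ.* + n ∎)
      where
      open ≡-Reasoning
      r≤e : n % d ≤ e
      r≤e = ℕ.≤-pred (m%n<n n d)
      i : Letter
      i = fromℕ< (index< r≤e)

  -- The length is exactly `L`, with zeros as the most significant digits where necessary, so that
  -- the word can replace a block of length `L` without moving the digits behind it.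
  represent : ∀ L z → ∣ z ∣ < d ^ L → ∃ λ w → length w ≡ L × value d w ≡ z
  represent L (+ n) n< with w , ∣w∣ , w≡ ← representMagnitude nonnegative L n n< =
    w , ∣w∣ , trans w≡ (ℤ.*-identityˡ (+ n))
  represent L -[1+ n ] n< with w , ∣w∣ , w≡ ← representMagnitude nonpositive L (suc n) n< =
    w , ∣w∣ , trans w≡ (ℤ.-1*i≡-i (+ suc n))

  -- Canonical representations

  naturalValue : List ℕ → ℕ
  naturalValue []       = 0
  naturalValue (r ∷ rs) = r ℕ.+ d ℕ.* naturalValue rs

  -- The last digit is nonzero if and only if every nonempty suffix has positive value.
  Canonical : List ℕ → Set
  Canonical []       = ⊤
  Canonical (r ∷ rs) = r ≤ e × Canonical rs × 0 < naturalValue (r ∷ rs)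

  nonzero : Letter → Bool
  nonzero i = 0 <ᵇ magnitude i

  magnitudes : Word → List ℕ
  magnitudes = map magnitude

  lastNonzero⇒canonical : ∀ w → lastOrEmpty nonzero w ≡ true → Canonical (magnitudes w)
  lastNonzero⇒canonical []          _  = tt
  lastNonzero⇒canonical (i ∷ [])    ok =
    magnitude≤e i , tt , ℕ.≤-trans (ℕ.<ᵇ⇒< 0 (magnitude i) (subst T (sym ok) tt)) (ℕ.m≤m+n _ _)
  lastNonzero⇒canonical (i ∷ j ∷ w) ok with c@(_ , _ , pos) ← lastNonzero⇒canonical (j ∷ w) ok =
    magnitude≤e i , c , ℕ.≤-trans pos (ℕ.≤-trans (ℕ.m≤n*m _ d) (ℕ.m≤n+m _ (magnitude i)))

  canonical⇒lastNonzero : ∀ w → Canonical (magnitudes w) → lastOrEmpty nonzero w ≡ true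
  canonical⇒lastNonzero []          _           = refl
  canonical⇒lastNonzero (i ∷ [])    (_ , _ , pos)
    rewrite ℕ.*-zeroʳ d | ℕ.+-identityʳ (magnitude i) with magnitude i
  ... | suc _ = refl
  canonical⇒lastNonzero (i ∷ j ∷ w) (_ , c , _) = canonical⇒lastNonzero (j ∷ w) c

  [r+d*n]%d : ∀ {r} n → r ≤ e → (r ℕ.+ d ℕ.* n) % d ≡ r
  [r+d*n]%d {r} n r≤e = begin
    (r ℕ.+ d ℕ.* n) % d  ≡⟨ cong (λ t → (r ℕ.+ t) % d) (ℕ.*-comm d n) ⟩
    (r ℕ.+ n ℕ.* d) % d  ≡⟨ [m+kn]%n≡m%n r n d ⟩
    r % d                ≡⟨ m<n⇒m%n≡m (s≤s r≤e) ⟩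
    r                    ∎
    where open ≡-Reasoning

  [r+d*n]/d : ∀ {r} n → r ≤ e → (r ℕ.+ d ℕ.* n) / d ≡ n
  [r+d*n]/d {r} n r≤e = begin
    (r ℕ.+ d ℕ.* n) / d    ≡⟨ cong (λ t → (r ℕ.+ t) / d) (ℕ.*-comm d n) ⟩
    (r ℕ.+ n ℕ.* d) / d    ≡⟨ +-distrib-/-∣ʳ r (n∣m*n n) ⟩
    r / d ℕ.+ n ℕ.* d / d  ≡⟨ cong₂ ℕ._+_ (m<n⇒m/n≡0 (s≤s r≤e)) (m*n/n≡m n d) ⟩
    n                      ∎
    where open ≡-Reasoning

  module _ (2≤d : 2 ≤ d) where

    -- As `2 ≤ d`, each division decreases a positive number, so fuel equal to the value suffices.
    -- Positivity of every nonempty suffix prevents `digitsF` from stopping before the end of `rs`.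
    digitsF-naturalValue : ∀ f rs → Canonical rs → naturalValue rs ≤ f → digitsF d f (naturalValue rs) ≡ rs
    digitsF-naturalValue zero    []       _ _ = refl
    digitsF-naturalValue (suc f) []       _ _ = refl
    digitsF-naturalValue zero    (r ∷ rs) (_ , _ , pos) ≤0 = contradiction (ℕ.≤-trans pos ≤0) λ ()
    digitsF-naturalValue (suc f) (r ∷ rs) (r≤e , c , pos) ≤f
      with naturalValue (r ∷ rs) in eq
    ... | suc n = cong₂ _∷_ mod-d (begin
      digitsF d f (suc n / d)         ≡⟨ cong (digitsF d f) div-d ⟩
      digitsF d f (naturalValue rs)   ≡⟨ digitsF-naturalValue f rs c
                                           (subst (_≤ f) div-d (ℕ.≤-pred (ℕ.<-≤-trans (m/n<m (suc n) d 2≤d) ≤f))) ⟩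
      rs ∎)
      where
      open ≡-Reasoning
      mod-d : suc n % d ≡ r
      mod-d = trans (cong (_% d) (sym eq)) ([r+d*n]%d (naturalValue rs) r≤e)
      div-d : suc n / d ≡ naturalValue rs
      div-d = trans (cong (_/ d) (sym eq)) ([r+d*n]/d (naturalValue rs) r≤e)

    naturalValue-digitsF : ∀ f n → n ≤ f → Canonical (digitsF d f n) × naturalValue (digitsF d f n) ≡ n
    naturalValue-digitsF zero    zero    _ = tt , refl
    naturalValue-digitsF (suc f) zero    _ = tt , refl
    naturalValue-digitsF (suc f) (suc n) n≤f
      with c , v ← naturalValue-digitsF f (suc n / d) (ℕ.≤-pred (ℕ.<-≤-trans (m/n<m (suc n) d 2≤d) n≤f)) =
      (ℕ.≤-pred (m%n<n (suc n) d) , c , subst (0 <_) (sym total) (s≤s z≤n)) , total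
      where
      open ≡-Reasoning
      total : suc n % d ℕ.+ d ℕ.* naturalValue (digitsF d f (suc n / d)) ≡ suc n
      total = begin
        suc n % d ℕ.+ d ℕ.* naturalValue (digitsF d f (suc n / d)) ≡⟨ cong (λ t → suc n % d ℕ.+ d ℕ.* t) v ⟩
        suc n % d ℕ.+ d ℕ.* (suc n / d)  ≡⟨ cong (suc n % d ℕ.+_) (ℕ.*-comm d (suc n / d)) ⟩
        suc n % d ℕ.+ suc n / d ℕ.* d    ≡⟨ m≡m%n+[m/n]*n (suc n) d ⟨
        suc n ∎

  module _ (o : Orientation) where
    open Orientation o

    oriented-magnitude : ∀ i → oriented i ≡ true → toℕ i ≡ index (magnitude i) × digitVal d i ≡ ε ℤ.* + magnitude i
    oriented-magnitude i ok with r , r≤e , i≡ ← oriented⁻ i ok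
      rewrite magnitude-unique o i r≤e i≡ = i≡ , digit i r≤e i≡

    oriented-value : ∀ w → all oriented w ≡ true → value d w ≡ ε ℤ.* + naturalValue (magnitudes w)
    oriented-value []      _  = sym (ℤ.*-zeroʳ ε)
    oriented-value (i ∷ w) ok = trans
      (cong₂ (λ s t → s ℤ.+ + d ℤ.* t) (proj₂ (oriented-magnitude i (∧-conicalˡ _ _ ok)))
                                       (oriented-value w (∧-conicalʳ _ _ ok)))
      (ε-distrib ε (magnitude i) (naturalValue (magnitudes w)))

    oriented-index : ∀ w → all oriented w ≡ true → map toℕ w ≡ map index (magnitudes w)
    oriented-index []      _  = refl
    oriented-index (i ∷ w) ok =
      cong₂ _∷_ (proj₁ (oriented-magnitude i (∧-conicalˡ _ _ ok))) (oriented-index w (∧-conicalʳ _ _ ok))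

    index⇒oriented : ∀ w rs → Canonical rs → map toℕ w ≡ map index rs → all oriented w ≡ true × magnitudes w ≡ rs
    index⇒oriented []      []       _              _  = refl , refl
    index⇒oriented (i ∷ w) (r ∷ rs) (r≤e , c , _) eq
      with i≡ , w≡ ← ∷-injective eq
      with ok , w≡rs ← index⇒oriented w rs c w≡ =
      trans (cong (_∧ all oriented w) (oriented⁺ i i≡)) ok , cong₂ _∷_ (magnitude-unique o i r≤e i≡) w≡rs

    ∣oriented-value∣ : ∀ w → all oriented w ≡ true → ∣ value d w ∣ ≡ naturalValue (magnitudes w)
    ∣oriented-value∣ w ok = begin
      ∣ value d w ∣              ≡⟨ cong ∣_∣ (oriented-value w ok) ⟩
      ∣ ε ℤ.* + v ∣              ≡⟨ ℤ.abs-* ε (+ v) ⟩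
      ∣ ε ∣ ℕ.* v                ≡⟨ cong (ℕ._* v) ∣ε∣≡1 ⟩
      1 ℕ.* v                    ≡⟨ ℕ.*-identityˡ v ⟩
      v                          ∎
      where
      open ≡-Reasoning
      v = naturalValue (magnitudes w)

    -- The absolute value modulo `d` is the magnitude of the first digit, and the common orientation
    -- `o` supplies its sign.
    firstLetter-determined : ∀ a x b y → all oriented (a ∷ x) ≡ true → all oriented (b ∷ y) ≡ true →
      ∣ value d (a ∷ x) ∣ ≡ ∣ value d (b ∷ y) ∣ → a ≡ b
    firstLetter-determined a x b y ok-x ok-y eq = Fin.toℕ-injective (begin
      toℕ a               ≡⟨ proj₁ (oriented-magnitude a (∧-conicalˡ _ _ ok-x)) ⟩
      index (magnitude a) ≡⟨ cong index same ⟩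
      index (magnitude b) ≡⟨ proj₁ (oriented-magnitude b (∧-conicalˡ _ _ ok-y)) ⟨
      toℕ b               ∎)
      where
      open ≡-Reasoning
      same : magnitude a ≡ magnitude b
      same = begin
        magnitude a ≡⟨ [r+d*n]%d (naturalValue (magnitudes x)) (magnitude≤e a) ⟨
        naturalValue (magnitudes (a ∷ x)) % d ≡⟨ cong (_% d) (∣oriented-value∣ (a ∷ x) ok-x) ⟨
        ∣ value d (a ∷ x) ∣ % d ≡⟨ cong (_% d) eq ⟩
        ∣ value d (b ∷ y) ∣ % d ≡⟨ cong (_% d) (∣oriented-value∣ (b ∷ y) ok-y) ⟩
        naturalValue (magnitudes (b ∷ y)) % d ≡⟨ [r+d*n]%d (naturalValue (magnitudes y)) (magnitude≤e b) ⟩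
        magnitude b ∎

  private
    module ⁺ = Orientation nonnegative
    module ⁻ = Orientation nonpositive

  -- The canonical representations of all integers: digits of one sign, and a most significant digit
  -- other than 0.
  canonicalForm : DFA (d ℕ.+ e)
  canonicalForm = product _∧_ (product _∨_ (allDFA ⁺.oriented) (allDFA ⁻.oriented)) (lastDFA nonzero)

  accepts-canonicalForm : ∀ w → accepts canonicalForm w ≡ (all ⁺.oriented w ∨ all ⁻.oriented w) ∧ lastOrEmpty nonzero w
  accepts-canonicalForm w = trans
    (accepts-product _∧_ (product _∨_ (allDFA ⁺.oriented) (allDFA ⁻.oriented)) (lastDFA nonzero) w)
    (cong₂ _∧_ (trans (accepts-product _∨_ (allDFA ⁺.oriented) (allDFA ⁻.oriented) w)
                 (cong₂ _∨_ (accepts-allDFA ⁺.oriented w) (accepts-allDFA ⁻.oriented w)))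
      (accepts-lastDFA nonzero w))

  canonicalForm-oriented : ∀ w → accepts canonicalForm w ≡ true →
    ∃ λ o → all (Orientation.oriented o) w ≡ true
  canonicalForm-oriented w acc with all ⁺.oriented w in eq | trans (sym (accepts-canonicalForm w)) acc
  ... | true  | _  = nonnegative , eq
  ... | false | ok = nonpositive , ∧-conicalˡ _ _ ok

  -- At `zero` both sides are empty, so words of nonpositive digits need no case distinction on
  -- whether their value is 0.
  canonIdx-neg : ∀ n → canonIdx d (ℤ.- + n) ≡ map ⁻.index (baseDigits d n)
  canonIdx-neg zero    = refl
  canonIdx-neg (suc n) = refl

  canonicalForm⇒canonIdx : 2 ≤ d → ∀ w → accepts canonicalForm w ≡ true → map toℕ w ≡ canonIdx d (value d w)
  canonicalForm⇒canonIdx 2≤d w acc = form (all ⁺.oriented w) refl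
    where
    open ≡-Reasoning
    ok : (all ⁺.oriented w ∨ all ⁻.oriented w) ∧ lastOrEmpty nonzero w ≡ true
    ok = trans (sym (accepts-canonicalForm w)) acc

    rs = magnitudes w

    rs≡ : baseDigits d (naturalValue rs) ≡ rs
    rs≡ = digitsF-naturalValue 2≤d _ rs (lastNonzero⇒canonical w (∧-conicalʳ _ _ ok)) ℕ.≤-refl

    form : ∀ b → all ⁺.oriented w ≡ b → map toℕ w ≡ canonIdx d (value d w)
    form true ok⁺ = begin
      map toℕ w                                   ≡⟨ oriented-index nonnegative w ok⁺ ⟩
      map ⁺.index rs                              ≡⟨ cong (map ⁺.index) rs≡ ⟨
      canonIdx d (+ naturalValue rs)
        ≡⟨ cong (canonIdx d) (trans (oriented-value nonnegative w ok⁺) (ℤ.*-identityˡ _)) ⟨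
      canonIdx d (value d w)                      ∎
    form false eq = begin
      map toℕ w                                   ≡⟨ oriented-index nonpositive w ok⁻ ⟩
      map ⁻.index rs                              ≡⟨ cong (map ⁻.index) rs≡ ⟨
      map ⁻.index (baseDigits d (naturalValue rs)) ≡⟨ canonIdx-neg (naturalValue rs) ⟨
      canonIdx d (ℤ.- + naturalValue rs)
        ≡⟨ cong (canonIdx d) (trans (oriented-value nonpositive w ok⁻) (ℤ.-1*i≡-i _)) ⟨
      canonIdx d (value d w)                      ∎
      where
      ok⁻ : all ⁻.oriented w ≡ true
      ok⁻ = trans (cong (_∨ all ⁻.oriented w) (sym eq)) (∧-conicalˡ _ _ ok)

  canonIdx⇒canonicalForm : 2 ≤ d → ∀ w a → map toℕ w ≡ canonIdx d a → accepts canonicalForm w ≡ true × value d w ≡ a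
  canonIdx⇒canonicalForm 2≤d w (+ n) eq
    with c , v ← naturalValue-digitsF 2≤d n n ℕ.≤-refl
    with ok , w≡ ← index⇒oriented nonnegative w (baseDigits d n) c eq =
    trans (accepts-canonicalForm w)
      (cong₂ _∧_ (cong (_∨ all ⁻.oriented w) ok) (canonical⇒lastNonzero w (subst Canonical (sym w≡) c))) ,
    (begin
      value d w                          ≡⟨ oriented-value nonnegative w ok ⟩
      + 1 ℤ.* + naturalValue (magnitudes w)  ≡⟨ ℤ.*-identityˡ _ ⟩
      + naturalValue (magnitudes w)      ≡⟨ cong (+_ ∘ naturalValue) w≡ ⟩
      + naturalValue (baseDigits d n)    ≡⟨ cong +_ v ⟩
      + n                                ∎)
    where open ≡-Reasoning
  canonIdx⇒canonicalForm 2≤d w -[1+ n ] eq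
    with c , v ← naturalValue-digitsF 2≤d (suc n) (suc n) ℕ.≤-refl
    with ok , w≡ ← index⇒oriented nonpositive w (baseDigits d (suc n)) c eq =
    trans (accepts-canonicalForm w)
      (cong₂ _∧_ (trans (cong (all ⁺.oriented w ∨_) ok) (∨-zeroʳ _))
                 (canonical⇒lastNonzero w (subst Canonical (sym w≡) c))) ,
    (begin
      value d w                          ≡⟨ oriented-value nonpositive w ok ⟩
      ℤ.-1ℤ ℤ.* + naturalValue (magnitudes w)  ≡⟨ ℤ.-1*i≡-i _ ⟩
      ℤ.- + naturalValue (magnitudes w)      ≡⟨ cong (λ t → ℤ.- + naturalValue t) w≡ ⟩
      ℤ.- + naturalValue (baseDigits d (suc n))    ≡⟨ cong (λ t → ℤ.- + t) v ⟩
      -[1+ n ]                                ∎)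
    where
    open ≡-Reasoning

  -- Loops of different values

  canonicalDFA : DFA (d ℕ.+ e) → DFA (d ℕ.+ e)
  canonicalDFA M = product _∧_ M canonicalForm

  canonicalDFA-recognises : 2 ≤ d → (A : ℤ → Set) (M : DFA (d ℕ.+ e)) →
    Recognises M (λ w → A (value d w)) → Recognises (canonicalDFA M) (CanonLang d A)
  canonicalDFA-recognises 2≤d A M rec w = mk⇔
    (λ (a , Aa , eq) → let acc , v = canonIdx⇒canonicalForm 2≤d w a eq in
      trans (accepts-product _∧_ M canonicalForm w)
        (cong₂ _∧_ (Equivalence.to (rec w) (subst A (sym v) Aa)) acc))
    (λ acc → let acc′ = trans (sym (accepts-product _∧_ M canonicalForm w)) acc in
      value d w , Equivalence.from (rec w) (∧-conicalˡ _ (accepts canonicalForm w) acc′)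
      , canonicalForm⇒canonIdx 2≤d w (∧-conicalʳ (accepts M w) _ acc′))

  -- The loops belong to the automaton that reads all words, since the words built from them later
  -- need not be canonical. The strict inequality gives different values and also keeps the absolute
  -- value of `x` at least 2 below `d ^ length x`, as that of `y` is smaller than this power too.
  record Pump (M : DFA (d ℕ.+ e)) : Set where
    field
      q           : Fin (nStates M)
      u x y w     : Word
      ∣x∣≡∣y∣     : length x ≡ length y
      x<y         : ∣ value d x ∣ < ∣ value d y ∣
      u-reaches   : run M (start M) u ≡ q
      loop-x      : run M q x ≡ q
      loop-y      : run M q y ≡ q
      w-accepted  : final M (run M q w) ≡ true

  -- Both loops occur inside canonical words, hence have digits of a common sign; as their first
  -- digits differ, so do their absolute values. Projection to the first factor of the product gives
  -- loops of `M`, and comparison of the values tells which one is `x`.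
  doubleLoop⇒pump : (M : DFA (d ℕ.+ e)) → DoubleLoop (canonicalDFA M) → Pump M
  doubleLoop⇒pump M L = orient (ℕ.<-cmp ∣ value d (a ∷ x) ∣ ∣ value d (b ∷ y) ∣)
    where
    open DoubleLoop L
    C = canonicalDFA M
    F = canonicalForm
    p₀ = run M (start M) u
    f₀ = run F (start F) u

    q≡ : q ≡ combine p₀ f₀
    q≡ = trans (sym u-reaches) (run-product _∧_ M F (start M) (start F) u)

    project : ∀ v → run C q v ≡ q → run M p₀ v ≡ p₀
    project v loop = Fin.combine-injectiveˡ (run M p₀ v) (run F f₀ v) p₀ f₀ (begin
      combine (run M p₀ v) (run F f₀ v)  ≡⟨ run-product _∧_ M F p₀ f₀ v ⟨
      run C (combine p₀ f₀) v            ≡⟨ cong (λ r → run C r v) q≡ ⟨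
      run C q v                          ≡⟨ loop ⟩
      q                                  ≡⟨ q≡ ⟩
      combine p₀ f₀                      ∎)
      where open ≡-Reasoning

    -- One accepted word through both loops, so that a single orientation covers the two.
    word : Word
    word = u ++ (a ∷ x) ++ (b ∷ y) ++ w

    word-accepted : accepts C word ≡ true
    word-accepted = trans (cong (final C) (begin
      run C (start C) word                      ≡⟨ foldl-++ (δ C) (start C) u _ ⟩
      run C (run C (start C) u) ((a ∷ x) ++ (b ∷ y) ++ w)
        ≡⟨ cong (λ r → run C r ((a ∷ x) ++ (b ∷ y) ++ w)) u-reaches ⟩
      run C q ((a ∷ x) ++ (b ∷ y) ++ w)         ≡⟨ foldl-++ (δ C) q (a ∷ x) _ ⟩
      run C (run C q (a ∷ x)) ((b ∷ y) ++ w)    ≡⟨ cong (λ r → run C r ((b ∷ y) ++ w)) loop-a∷x ⟩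
      run C q ((b ∷ y) ++ w)                    ≡⟨ foldl-++ (δ C) q (b ∷ y) _ ⟩
      run C (run C q (b ∷ y)) w                 ≡⟨ cong (λ r → run C r w) loop-b∷y ⟩
      run C q w                                 ∎)) w-accepted
      where open ≡-Reasoning

    M-accepted : final M (run M p₀ w) ≡ true
    M-accepted = ∧-conicalˡ _ _ (begin
      final M (run M p₀ w) ∧ final F (run F f₀ w)
        ≡⟨ cong (λ (p , q) → final M p ∧ final F q) (Fin.remQuot-combine (run M p₀ w) (run F f₀ w)) ⟨
      final C (combine (run M p₀ w) (run F f₀ w)) ≡⟨ cong (final C) (run-product _∧_ M F p₀ f₀ w) ⟨
      final C (run C (combine p₀ f₀) w)           ≡⟨ cong (λ r → final C (run C r w)) q≡ ⟨
      final C (run C q w)                         ≡⟨ w-accepted ⟩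
      true ∎)
      where open ≡-Reasoning

    distinct : ∣ value d (a ∷ x) ∣ ≢ ∣ value d (b ∷ y) ∣
    distinct eq
      with o , ok ← canonicalForm-oriented word
             (∧-conicalʳ (accepts M word) _ (trans (sym (accepts-product _∧_ M F word)) word-accepted))
      with _ , ok′ ← all-++⁻ _ u _ ok
      with ok-x , ok″ ← all-++⁻ _ (a ∷ x) _ ok′
      with ok-y , _ ← all-++⁻ _ (b ∷ y) w ok″ =
      a≢b (firstLetter-determined o a x b y ok-x ok-y eq)

    orient : Tri (∣ value d (a ∷ x) ∣ < ∣ value d (b ∷ y) ∣) (∣ value d (a ∷ x) ∣ ≡ ∣ value d (b ∷ y) ∣)
                 (∣ value d (b ∷ y) ∣ < ∣ value d (a ∷ x) ∣) → Pump M
    orient (tri< x<y _ _) = record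
      { q = p₀ ; u = u ; x = a ∷ x ; y = b ∷ y ; w = w ; ∣x∣≡∣y∣ = cong suc ∣x∣≡∣y∣ ; x<y = x<y
      ; u-reaches = refl ; loop-x = project (a ∷ x) loop-a∷x ; loop-y = project (b ∷ y) loop-b∷y ; w-accepted = M-accepted }
    orient (tri≈ _ eq _) = contradiction eq distinct
    orient (tri> _ _ y<x) = record
      { q = p₀ ; u = u ; x = b ∷ y ; y = a ∷ x ; w = w ; ∣x∣≡∣y∣ = cong suc (sym ∣x∣≡∣y∣) ; x<y = y<x
      ; u-reaches = refl ; loop-x = project (b ∷ y) loop-b∷y ; loop-y = project (a ∷ x) loop-a∷x ; w-accepted = M-accepted }

-- Repeated words and their action on states

rep : ℕ → List A → List A
rep zero    v = []
rep (suc n) v = v ++ rep n v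

rep-+ : ∀ m n (v : List A) → rep (m ℕ.+ n) v ≡ rep m v ++ rep n v
rep-+ zero    n v = refl
rep-+ (suc m) n v = trans (cong (v ++_) (rep-+ m n v)) (sym (++-assoc v (rep m v) (rep n v)))

rep-* : ∀ m n (v : List A) → rep m (rep n v) ≡ rep (m ℕ.* n) v
rep-* zero    n v = refl
rep-* (suc m) n v = trans (cong (rep n v ++_) (rep-* m n v)) (sym (rep-+ n (m ℕ.* n) v))

rep-comm : ∀ n (v : List A) → rep n v ++ v ≡ rep (suc n) v
rep-comm n v = begin
  rep n v ++ v           ≡⟨ cong (rep n v ++_) (++-identityʳ v) ⟨
  rep n v ++ rep 1 v     ≡⟨ rep-+ n 1 v ⟨
  rep (n ℕ.+ 1) v        ≡⟨ cong (λ k → rep k v) (ℕ.+-comm n 1) ⟩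
  rep (suc n) v          ∎
  where open ≡-Reasoning

length-rep : ∀ n (v : List A) → length (rep n v) ≡ n ℕ.* length v
length-rep zero    v = refl
length-rep (suc n) v = trans (length-++ v) (cong (length v ℕ.+_) (length-rep n v))

n≤n! : ∀ n → n ≤ n !
n≤n! zero    = z≤n
n≤n! (suc n) = ℕ.m≤m*n (suc n) (n !) {{n ℕ.!≢0}}

module _ (D : DFA m) where

  private N = nStates D

  _≈_ : List (Fin m) → List (Fin m) → Set
  v ≈ w = ∀ q → run D q v ≡ run D q w

  run-++ : ∀ q v w → run D q (v ++ w) ≡ run D (run D q v) w
  run-++ q v w = foldl-++ (δ D) q v w

  ≈-++ : ∀ v v′ w w′ → v ≈ v′ → w ≈ w′ → (v ++ w) ≈ (v′ ++ w′)
  ≈-++ v v′ w w′ v≈ w≈ q = begin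
    run D q (v ++ w)           ≡⟨ run-++ q v w ⟩
    run D (run D q v) w        ≡⟨ cong (λ p → run D p w) (v≈ q) ⟩
    run D (run D q v′) w       ≡⟨ w≈ _ ⟩
    run D (run D q v′) w′      ≡⟨ run-++ q v′ w′ ⟨
    run D q (v′ ++ w′)         ∎
    where open ≡-Reasoning

  rep-absorbed : ∀ n v w → (v ++ w) ≈ w → (rep n v ++ w) ≈ w
  rep-absorbed zero    v w vw≈w q = refl
  rep-absorbed (suc n) v w vw≈w q = begin
    run D q ((v ++ rep n v) ++ w)  ≡⟨ cong (run D q) (++-assoc v (rep n v) w) ⟩
    run D q (v ++ (rep n v ++ w))  ≡⟨ ≈-++ v v _ _ (λ _ → refl) (rep-absorbed n v w vw≈w) q ⟩
    run D q (v ++ w)               ≡⟨ vw≈w q ⟩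
    run D q w                      ∎
    where open ≡-Reasoning

  run-rep-loop : ∀ n {q} v → run D q v ≡ q → run D q (rep n v) ≡ q
  run-rep-loop zero    v loop = refl
  run-rep-loop (suc n) {q} v loop = begin
    run D q (v ++ rep n v)         ≡⟨ run-++ q v (rep n v) ⟩
    run D (run D q v) (rep n v)    ≡⟨ cong (λ p → run D p (rep n v)) loop ⟩
    run D q (rep n v)              ≡⟨ run-rep-loop n v loop ⟩
    q                              ∎
    where open ≡-Reasoning

  -- n! exceeds the preperiod and is a multiple of the period of every
  -- self-map of an n-element set.
  rep-factorial : ∀ c v → rep (c ℕ.* N ! ℕ.+ N !) v ≈ rep (N !) v
  rep-factorial c v q
    with i , j , i<j , same ← pigeonhole (ℕ.n<1+n N) (λ i → run D q (rep (toℕ i) v))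
    with l , i+l≡j ← ℕ.m≤n⇒∃[o]m+o≡n i<j
    = go
    where
    open ≡-Reasoning
    p = suc l
    j≤N : toℕ j ≤ N
    j≤N = ℕ.≤-pred (Fin.toℕ<n j)

    j≡ : toℕ j ≡ toℕ i ℕ.+ p
    j≡ = trans (sym i+l≡j) (sym (ℕ.+-suc (toℕ i) l))

    p≤N : p ≤ N
    p≤N = ℕ.≤-trans (ℕ.m≤n+m p (toℕ i)) (subst (_≤ N) j≡ j≤N)

    periodic : ∀ r → run D q (rep (p ℕ.+ (toℕ i ℕ.+ r)) v) ≡ run D q (rep (toℕ i ℕ.+ r) v)
    periodic r = begin
      run D q (rep (p ℕ.+ (toℕ i ℕ.+ r)) v)
        ≡⟨ cong (λ k → run D q (rep k v))
             (trans (sym (ℕ.+-assoc p (toℕ i) r)) (cong (ℕ._+ r) (trans (ℕ.+-comm p (toℕ i)) (sym j≡)))) ⟩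
      run D q (rep (toℕ j ℕ.+ r) v)                ≡⟨ cong (run D q) (rep-+ (toℕ j) r v) ⟩
      run D q (rep (toℕ j) v ++ rep r v)           ≡⟨ run-++ q (rep (toℕ j) v) (rep r v) ⟩
      run D (run D q (rep (toℕ j) v)) (rep r v)    ≡⟨ cong (λ s → run D s (rep r v)) same ⟨
      run D (run D q (rep (toℕ i) v)) (rep r v)    ≡⟨ run-++ q (rep (toℕ i) v) (rep r v) ⟨
      run D q (rep (toℕ i) v ++ rep r v)           ≡⟨ cong (run D q) (rep-+ (toℕ i) r v) ⟨
      run D q (rep (toℕ i ℕ.+ r) v)                ∎

    periods : ∀ b r → run D q (rep (b ℕ.* p ℕ.+ (toℕ i ℕ.+ r)) v) ≡ run D q (rep (toℕ i ℕ.+ r) v)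
    periods zero    r = refl
    periods (suc b) r = begin
      run D q (rep (p ℕ.+ b ℕ.* p ℕ.+ (toℕ i ℕ.+ r)) v)
        ≡⟨ cong (λ k → run D q (rep k v)) (shuffle p (b ℕ.* p) (toℕ i) r) ⟩
      run D q (rep (p ℕ.+ (toℕ i ℕ.+ (b ℕ.* p ℕ.+ r))) v)  ≡⟨ periodic (b ℕ.* p ℕ.+ r) ⟩
      run D q (rep (toℕ i ℕ.+ (b ℕ.* p ℕ.+ r)) v)
        ≡⟨ cong (λ k → run D q (rep k v)) (shuffle′ (b ℕ.* p) (toℕ i) r) ⟩
      run D q (rep (b ℕ.* p ℕ.+ (toℕ i ℕ.+ r)) v)          ≡⟨ periods b r ⟩
      run D q (rep (toℕ i ℕ.+ r) v) ∎
      where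
      shuffle : ∀ p b i r → p ℕ.+ b ℕ.+ (i ℕ.+ r) ≡ p ℕ.+ (i ℕ.+ (b ℕ.+ r))
      shuffle = solveℕ-∀
      shuffle′ : ∀ b i r → i ℕ.+ (b ℕ.+ r) ≡ b ℕ.+ (i ℕ.+ r)
      shuffle′ = solveℕ-∀

    p∣N! : p ∣ N !
    p∣N! = ∣-trans (m∣m*n (l !)) (m≤n⇒m!∣n! p≤N)

    go : run D q (rep (c ℕ.* N ! ℕ.+ N !) v) ≡ run D q (rep (N !) v)
    go with divides b eq ← p∣N!
          | r , i+r≡ ← ℕ.m≤n⇒∃[o]m+o≡n (ℕ.≤-trans (ℕ.<⇒≤ i<j) (ℕ.≤-trans j≤N (n≤n! N)))
      = begin
        run D q (rep (c ℕ.* N ! ℕ.+ N !) v)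
          ≡⟨ cong₂ (λ s t → run D q (rep (s ℕ.+ t) v)) (trans (cong (c ℕ.*_) eq) (sym (ℕ.*-assoc c b p))) (sym i+r≡) ⟩
        run D q (rep (c ℕ.* b ℕ.* p ℕ.+ (toℕ i ℕ.+ r)) v)     ≡⟨ periods (c ℕ.* b) r ⟩
        run D q (rep (toℕ i ℕ.+ r) v)                         ≡⟨ cong (λ k → run D q (rep k v)) i+r≡ ⟩
        run D q (rep (N !) v)                                 ∎

-- Values of words with repeated blocks

module Progressions (e : ℕ) where
  open Base e

  -- Equal lengths keep the digits of `z` in place, so only the block changes, and its value counts
  -- with the weight of its position. Read backwards, adding a suitably scaled `c` to a number
  -- exchanges one block of a word for another.
  value-replace : ∀ p v σ z c → length σ ≡ length v → value d σ ≡ value d v ℤ.+ c →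
    value d (p ++ σ ++ z) ≡ + (d ^ length p) ℤ.* c ℤ.+ value d (p ++ v ++ z)
  value-replace p v σ z c ∣σ∣≡∣v∣ σ≡ = begin
    value d (p ++ σ ++ z)   ≡⟨ value-++ p (σ ++ z) ⟩
    P ℤ.+ D ℤ.* value d (σ ++ z)  ≡⟨ cong (λ t → P ℤ.+ D ℤ.* t) (value-++ σ z) ⟩
    P ℤ.+ D ℤ.* (value d σ ℤ.+ + (d ^ length σ) ℤ.* Z)
      ≡⟨ cong₂ (λ s t → P ℤ.+ D ℤ.* (s ℤ.+ + (d ^ t) ℤ.* Z)) σ≡ ∣σ∣≡∣v∣ ⟩
    P ℤ.+ D ℤ.* (value d v ℤ.+ c ℤ.+ E ℤ.* Z)
      ≡⟨ rearrange P D (value d v) c (E ℤ.* Z) ⟩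
    D ℤ.* c ℤ.+ (P ℤ.+ D ℤ.* (value d v ℤ.+ E ℤ.* Z))
      ≡⟨ cong (λ t → D ℤ.* c ℤ.+ (P ℤ.+ D ℤ.* t)) (value-++ v z) ⟨
    D ℤ.* c ℤ.+ (P ℤ.+ D ℤ.* value d (v ++ z))
      ≡⟨ cong (λ t → D ℤ.* c ℤ.+ t) (value-++ p (v ++ z)) ⟨
    D ℤ.* c ℤ.+ value d (p ++ v ++ z) ∎
    where
    open ≡-Reasoning
    P = value d p
    D = + (d ^ length p)
    E = + (d ^ length v)
    Z = value d z
    rearrange : ∀ P D v c z → P ℤ.+ D ℤ.* (v ℤ.+ c ℤ.+ z) ≡ D ℤ.* c ℤ.+ (P ℤ.+ D ℤ.* (v ℤ.+ z))
    rearrange = solve-∀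

  -- A slack of 2 below `d ^ length x` grows with every copy. A slack of 1, as for a word of digits
  -- `e` only, would remain 1 forever.
  ∣value-rep∣ : ∀ x → 2 ℕ.+ ∣ value d x ∣ ≤ d ^ length x →
    ∀ k → ∣ value d (rep k x) ∣ ℕ.+ k < d ^ length (rep k x)
  ∣value-rep∣ x x< zero = s≤s z≤n
  ∣value-rep∣ x x< (suc k) = begin
    suc (∣ value d (x ++ rep k x) ∣ ℕ.+ suc k)
      ≡⟨ cong (λ t → suc (∣ t ∣ ℕ.+ suc k)) (value-++ x (rep k x)) ⟩
    suc (∣ value d x ℤ.+ + X ℤ.* value d (rep k x) ∣ ℕ.+ suc k)
      ≤⟨ s≤s (ℕ.+-monoˡ-≤ (suc k) (ℕ.≤-trans (ℤ.∣i+j∣≤∣i∣+∣j∣ (value d x) _)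
          (ℕ.≤-reflexive (cong (∣ value d x ∣ ℕ.+_) (ℤ.abs-* (+ X) (value d (rep k x))))))) ⟩
    suc (∣ value d x ∣ ℕ.+ X ℕ.* R ℕ.+ suc k)
      ≡⟨ shuffle ∣ value d x ∣ (X ℕ.* R) k ⟩
    2 ℕ.+ ∣ value d x ∣ ℕ.+ (X ℕ.* R ℕ.+ k)
      ≤⟨ ℕ.+-mono-≤ x< (ℕ.+-monoʳ-≤ (X ℕ.* R) (ℕ.m≤n*m k X {{ℕ.>-nonZero (ℕ.≤-trans (s≤s z≤n) x<)}})) ⟩
    X ℕ.+ (X ℕ.* R ℕ.+ X ℕ.* k)
      ≡⟨ factor X R k ⟩
    X ℕ.* suc (R ℕ.+ k)
      ≤⟨ ℕ.*-monoʳ-≤ X (∣value-rep∣ x x< k) ⟩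
    X ℕ.* d ^ length (rep k x)
      ≡⟨ ℕ.^-distribˡ-+-* d (length x) (length (rep k x)) ⟨
    d ^ (length x ℕ.+ length (rep k x))
      ≡⟨ cong (d ^_) (length-++ x) ⟨
    d ^ length (rep (suc k) x) ∎
    where
    open ℕ.≤-Reasoning
    X = d ^ length x
    R = ∣ value d (rep k x) ∣
    shuffle : ∀ v r k → suc (v ℕ.+ r ℕ.+ suc k) ≡ 2 ℕ.+ v ℕ.+ (r ℕ.+ k)
    shuffle = solveℕ-∀
    factor : ∀ X R k → X ℕ.+ (X ℕ.* R ℕ.+ X ℕ.* k) ≡ X ℕ.* suc (R ℕ.+ k)
    factor = solveℕ-∀

  -- Each exchanged copy contributes a power of `d` times the same difference, so the contributions
  -- cannot cancel. Writing the coefficient as `suc g` records that it is positive.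
  value-rep-difference : ∀ s x y → length x ≡ length y → ∀ n → ∃ λ g →
    value d (rep (suc n) (s ++ y)) ≡ value d (rep (suc n) (s ++ x)) ℤ.+ + suc g ℤ.* (value d y ℤ.- value d x)
  value-rep-difference s x y ∣x∣≡∣y∣ = go
    where
    c = value d y ℤ.- value d x
    L = length (s ++ x)
    S = length s

    positive-^ : ∀ n → ∃ λ g → d ^ n ≡ suc g
    positive-^ n with d ^ n | ℕ.m^n>0 d n
    ... | suc g | _ = g , refl

    ∣sy∣≡ : length (s ++ y) ≡ L
    ∣sy∣≡ = trans (length-++ s) (trans (cong (S ℕ.+_) (sym ∣x∣≡∣y∣)) (sym (length-++ s)))

    block : value d (s ++ y) ≡ value d (s ++ x) ℤ.+ + (d ^ S) ℤ.* c
    block = begin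
      value d (s ++ y)  ≡⟨ value-++ s y ⟩
      value d s ℤ.+ + (d ^ S) ℤ.* value d y  ≡⟨ rearrange (value d s) (+ (d ^ S)) (value d x) (value d y) ⟩
      value d s ℤ.+ + (d ^ S) ℤ.* value d x ℤ.+ + (d ^ S) ℤ.* c ≡⟨ cong (ℤ._+ + (d ^ S) ℤ.* c) (value-++ s x) ⟨
      value d (s ++ x) ℤ.+ + (d ^ S) ℤ.* c ∎
      where
      open ≡-Reasoning
      rearrange : ∀ s p x y → s ℤ.+ p ℤ.* y ≡ s ℤ.+ p ℤ.* x ℤ.+ p ℤ.* (y ℤ.- x)
      rearrange = solve-∀

    go : ∀ n → ∃ λ g → value d (rep (suc n) (s ++ y)) ≡ value d (rep (suc n) (s ++ x)) ℤ.+ + suc g ℤ.* c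
    go zero with g , eq ← positive-^ S = g , (begin
      value d ((s ++ y) ++ [])  ≡⟨ cong (value d) (++-identityʳ (s ++ y)) ⟩
      value d (s ++ y)          ≡⟨ block ⟩
      value d (s ++ x) ℤ.+ + (d ^ S) ℤ.* c
        ≡⟨ cong₂ (λ v t → value d v ℤ.+ + t ℤ.* c) (sym (++-identityʳ (s ++ x))) eq ⟩
      value d ((s ++ x) ++ []) ℤ.+ + suc g ℤ.* c ∎)
      where open ≡-Reasoning
    -- The first block contributes `d ^ S`, which is `suc h`; the remaining blocks are moved by the
    -- factor `d ^ L`.
    go (suc n) with g , eq ← go n | h , eq′ ← positive-^ S = h ℕ.+ d ^ L ℕ.* suc g , (begin
      value d ((s ++ y) ++ Y)   ≡⟨ value-++ (s ++ y) Y ⟩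
      value d (s ++ y) ℤ.+ + (d ^ length (s ++ y)) ℤ.* value d Y
        ≡⟨ cong₂ ℤ._+_ block (cong₂ (λ l t → + (d ^ l) ℤ.* t) ∣sy∣≡ eq) ⟩
      value d (s ++ x) ℤ.+ + (d ^ S) ℤ.* c ℤ.+ + (d ^ L) ℤ.* (value d X ℤ.+ + suc g ℤ.* c)
        ≡⟨ rearrange (value d (s ++ x)) (+ (d ^ S)) (+ (d ^ L)) (value d X) (+ suc g) c ⟩
      value d (s ++ x) ℤ.+ + (d ^ L) ℤ.* value d X ℤ.+ (+ (d ^ S) ℤ.+ + (d ^ L) ℤ.* + suc g) ℤ.* c
        ≡⟨ cong₂ (λ v t → v ℤ.+ t ℤ.* c) (sym (value-++ (s ++ x) X))
             (cong₂ ℤ._+_ (cong +_ eq′) (sym (ℤ.pos-* (d ^ L) (suc g)))) ⟩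
      value d ((s ++ x) ++ X) ℤ.+ + suc (h ℕ.+ d ^ L ℕ.* suc g) ℤ.* c ∎)
      where
      open ≡-Reasoning
      X = rep (suc n) (s ++ x)
      Y = rep (suc n) (s ++ y)
      rearrange : ∀ a p l x g c → a ℤ.+ p ℤ.* c ℤ.+ l ℤ.* (x ℤ.+ g ℤ.* c) ≡ a ℤ.+ l ℤ.* x ℤ.+ (p ℤ.+ l ℤ.* g) ℤ.* c
      rearrange = solve-∀


  n<d^n : 2 ≤ d → ∀ n → n < d ^ n
  n<d^n 2≤d zero    = s≤s z≤n
  n<d^n 2≤d (suc n) = begin
    suc (suc n)              ≡⟨ ℕ.+-comm 1 (suc n) ⟩
    suc n ℕ.+ 1              ≤⟨ ℕ.+-mono-≤ (n<d^n 2≤d n) (ℕ.m^n>0 d n) ⟩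
    d ^ n ℕ.+ d ^ n          ≡⟨ cong (d ^ n ℕ.+_) (ℕ.+-identityʳ (d ^ n)) ⟨
    2 ℕ.* d ^ n              ≤⟨ ℕ.*-monoˡ-≤ (d ^ n) 2≤d ⟩
    d ^ suc n                ∎
    where open ℕ.≤-Reasoning

  -- Stability forces arithmetic progressions

  module Recognised (2≤d : 2 ≤ d) (A : ℤ → Set) (M : DFA (d ℕ.+ e))
    (rec : Recognises M (λ w → A (value d w))) where

    private
      infix 4 _∼_
      _∼_ : Word → Word → Set
      _∼_ = _≈_ M

    accepted⇒A : ∀ w → accepts M w ≡ true → A (value d w)
    accepted⇒A w = Equivalence.from (rec w)

    A⇒accepted : ∀ w → A (value d w) → accepts M w ≡ true
    A⇒accepted w = Equivalence.to (rec w)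

    wordOf : ∀ z → ∃ λ w → value d w ≡ z
    wordOf z with w , _ , w≡ ← represent ∣ z ∣ z (n<d^n 2≤d ∣ z ∣) = w , w≡

    A? : ∀ z → Dec (A z)
    A? z with w , w≡ ← wordOf z =
      map′ (subst A w≡ ∘ accepted⇒A w) (A⇒accepted w ∘ subst A (sym w≡)) (accepts M w ≟ᵇ true)

    module _ {N : ℕ} (stable : ∀ (a b : Fin (suc N) → ℤ) → ¬ (∀ i j → A (a i ℤ.+ b j) ⇔ (i Fin.≤ j))) where

      -- Inequalities of indices are expressed by their differences `p` and `r`, because these are
      -- the numbers of blocks between and behind the places concerned.
      ¬ladder : (a b : ℕ → ℤ) →
        (∀ i p r → i ℕ.+ p ℕ.+ r ≡ N → A (a i ℤ.+ b (i ℕ.+ p))) →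
        (∀ j p r → suc j ℕ.+ p ℕ.+ r ≡ N → A (a (suc j ℕ.+ p) ℤ.+ b j) → ⊥) → ⊥
      ¬ladder a b below above = stable (a ∘ toℕ) (b ∘ toℕ) λ i j → mk⇔
        (λ Aij → ℕ.≮⇒≥ λ j<i →
          let p , j+p≡i = ℕ.m≤n⇒∃[o]m+o≡n j<i
              r , i+r≡N = ℕ.m≤n⇒∃[o]m+o≡n (ℕ.≤-pred (Fin.toℕ<n i))
          in above (toℕ j) p r (trans (cong (ℕ._+ r) j+p≡i) i+r≡N)
               (subst (λ k → A (a k ℤ.+ b (toℕ j))) (sym j+p≡i) Aij))
        (λ i≤j →
          let p , i+p≡j = ℕ.m≤n⇒∃[o]m+o≡n i≤j
              r , j+r≡N = ℕ.m≤n⇒∃[o]m+o≡n (ℕ.≤-pred (Fin.toℕ<n j))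
          in subst (λ k → A (a (toℕ i) ℤ.+ b k)) i+p≡j (below (toℕ i) p r (trans (cong (ℕ._+ r) i+p≡j) j+r≡N)))

      module _ (q : Fin (nStates M)) (u v₁ v₂ w : Word) (h : ℤ)
        (∣v₁∣≡∣v₂∣ : length v₁ ≡ length v₂)
        (v₂≡ : value d v₂ ≡ value d v₁ ℤ.+ h)
        (u-reaches : run M (start M) u ≡ q)
        (loop₁ : run M q v₁ ≡ q) (loop₂ : run M q v₂ ≡ q)
        (w-accepted : final M (run M q w) ≡ true)
        (absorb₁ : v₁ ++ v₂ ∼ v₂) (absorb₂ : v₂ ++ v₂ ∼ v₂) where

        private
          ℓ = length v₁

        -- Blocks of length `ℓ` act as digits in base `d ^ ℓ`; this is the digit `k` steps of size
        -- `h` above that of `v₁`.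
        DigitAt : ℕ → Word → Set
        DigitAt k σ = length σ ≡ ℓ × value d σ ≡ value d v₁ ℤ.+ + k ℤ.* h

        -- There are `N + 1` blocks, numbered from 0, and block `i` is `v₁` exactly if `i ≤ j`. The
        -- additional `v₂` absorbs the blocks behind one that is changed.
        tower : ℕ → ℤ
        tower j = value d (u ++ rep (suc j) v₁ ++ rep (N ∸ j) v₂ ++ v₂ ++ w)

        -- The weight of block `i` times `k * h`: added to a tower, it raises this block by `k`
        -- steps.
        offset : ℕ → ℕ → ℤ
        offset k i = + (d ^ (length u ℕ.+ i ℕ.* ℓ)) ℤ.* (+ k ℤ.* h)

        loops : ∀ a b → run M q (rep a v₁ ++ rep b v₂) ≡ q
        loops a b = begin
          run M q (rep a v₁ ++ rep b v₂)           ≡⟨ run-++ M q (rep a v₁) (rep b v₂) ⟩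
          run M (run M q (rep a v₁)) (rep b v₂)    ≡⟨ cong (λ s → run M s (rep b v₂)) (run-rep-loop M a v₁ loop₁) ⟩
          run M q (rep b v₂)                       ≡⟨ run-rep-loop M b v₂ loop₂ ⟩
          q                                        ∎
          where open ≡-Reasoning

        absorb : ∀ a b → rep a v₁ ++ rep b v₂ ++ v₂ ∼ v₂
        absorb a b q = trans
          (≈-++ M (rep a v₁) (rep a v₁) (rep b v₂ ++ v₂) v₂ (λ _ → refl) (rep-absorbed M b v₂ v₂ absorb₂) q)
          (rep-absorbed M a v₁ v₂ absorb₁ q)

        inserted : ℕ → ℕ → Word → ℕ → ℕ → Word
        inserted a b σ c b′ = (u ++ rep a v₁ ++ rep b v₂) ++ σ ++ rep c v₁ ++ rep b′ v₂ ++ v₂ ++ w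

        -- The blocks before `σ` are loops at `q`, and those behind it vanish into the last `v₂`.
        -- Hence acceptance depends on `σ` alone and not on its position.
        accepts-inserted : ∀ a b σ c b′ → accepts M (inserted a b σ c b′) ≡
          accepts M (u ++ σ ++ v₂ ++ w)
        accepts-inserted a b σ c b′ = cong (final M) (begin
          run M (start M) ((u ++ rep a v₁ ++ rep b v₂) ++ σ ++ rest)
            ≡⟨ run-++ M (start M) (u ++ rep a v₁ ++ rep b v₂) (σ ++ rest) ⟩
          run M (run M (start M) (u ++ rep a v₁ ++ rep b v₂)) (σ ++ rest)
            ≡⟨ cong (λ s → run M s (σ ++ rest)) (trans (run-++ M (start M) u _)
                 (trans (cong (λ s → run M s (rep a v₁ ++ rep b v₂)) u-reaches) (loops a b))) ⟩
          run M q (σ ++ rest)                   ≡⟨ cong (λ t → run M q (σ ++ t)) rest≡ ⟩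
          run M q (σ ++ (rep c v₁ ++ rep b′ v₂ ++ v₂) ++ w)
            ≡⟨ ≈-++ M σ σ _ (v₂ ++ w) (λ _ → refl)
                 (≈-++ M (rep c v₁ ++ rep b′ v₂ ++ v₂) v₂ w w (absorb c b′) (λ _ → refl)) q ⟩
          run M q (σ ++ v₂ ++ w)             ≡⟨ cong (λ s → run M s (σ ++ v₂ ++ w)) u-reaches ⟨
          run M (run M (start M) u) (σ ++ v₂ ++ w) ≡⟨ run-++ M (start M) u _ ⟨
          run M (start M) (u ++ σ ++ v₂ ++ w) ∎)
          where
          open ≡-Reasoning
          rest = rep c v₁ ++ rep b′ v₂ ++ v₂ ++ w
          rest≡ : rest ≡ (rep c v₁ ++ rep b′ v₂ ++ v₂) ++ w
          rest≡ = trans (cong (rep c v₁ ++_) (sym (++-assoc (rep b′ v₂) v₂ w))) (sym (++-assoc (rep c v₁) _ w))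

        length-prefix : ∀ a b → length (u ++ rep a v₁ ++ rep b v₂) ≡ length u ℕ.+ (a ℕ.+ b) ℕ.* ℓ
        length-prefix a b = begin
          length (u ++ rep a v₁ ++ rep b v₂)              ≡⟨ length-++ u ⟩
          length u ℕ.+ length (rep a v₁ ++ rep b v₂)      ≡⟨ cong (length u ℕ.+_) (length-++ (rep a v₁)) ⟩
          length u ℕ.+ (length (rep a v₁) ℕ.+ length (rep b v₂))
            ≡⟨ cong (length u ℕ.+_)
                 (cong₂ ℕ._+_ (length-rep a v₁) (trans (length-rep b v₂) (cong (b ℕ.*_) (sym ∣v₁∣≡∣v₂∣)))) ⟩
          length u ℕ.+ (a ℕ.* ℓ ℕ.+ b ℕ.* ℓ)              ≡⟨ cong (length u ℕ.+_) (ℕ.*-distribʳ-+ ℓ a b) ⟨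
          length u ℕ.+ (a ℕ.+ b) ℕ.* ℓ                    ∎
          where open ≡-Reasoning

        -- Here the raised block is a `v₁`, so `k` steps lead to the digit `k`.
        tower-in-run₁ : ∀ k σ → DigitAt k σ → ∀ i p r → i ℕ.+ p ℕ.+ r ≡ N →
          offset k i ℤ.+ tower (i ℕ.+ p) ≡
          value d (inserted i 0 σ p r)
        tower-in-run₁ k σ (∣σ∣ , σ≡) i p r eq = sym (begin
          value d (P ++ σ ++ Z)                   ≡⟨ value-replace P v₁ σ Z (+ k ℤ.* h) ∣σ∣ σ≡ ⟩
          + (d ^ length P) ℤ.* (+ k ℤ.* h) ℤ.+ value d (P ++ v₁ ++ Z)
            ≡⟨ cong₂ (λ l z → + (d ^ l) ℤ.* (+ k ℤ.* h) ℤ.+ value d z)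
                 (trans (length-prefix i 0) (cong (λ t → length u ℕ.+ t ℕ.* ℓ) (ℕ.+-identityʳ i))) reassociate ⟩
          offset k i ℤ.+ tower (i ℕ.+ p)          ∎)
          where
          open ≡-Reasoning
          P = u ++ rep i v₁ ++ []
          Z = rep p v₁ ++ rep r v₂ ++ v₂ ++ w
          reassociate : P ++ v₁ ++ Z ≡ u ++ rep (suc (i ℕ.+ p)) v₁ ++ rep (N ∸ (i ℕ.+ p)) v₂ ++ v₂ ++ w
          reassociate = begin
            P ++ v₁ ++ Z                          ≡⟨ cong (λ t → (u ++ t) ++ v₁ ++ Z) (++-identityʳ (rep i v₁)) ⟩
            (u ++ rep i v₁) ++ v₁ ++ Z            ≡⟨ ++-assoc u (rep i v₁) _ ⟩
            u ++ rep i v₁ ++ v₁ ++ rep p v₁ ++ Y  ≡⟨ cong (λ t → u ++ rep i v₁ ++ t) (++-assoc v₁ (rep p v₁) Y) ⟨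
            u ++ rep i v₁ ++ rep (suc p) v₁ ++ Y  ≡⟨ cong (u ++_) (++-assoc (rep i v₁) (rep (suc p) v₁) Y) ⟨
            u ++ (rep i v₁ ++ rep (suc p) v₁) ++ Y ≡⟨ cong (λ t → u ++ t ++ Y) (rep-+ i (suc p) v₁) ⟨
            u ++ rep (i ℕ.+ suc p) v₁ ++ Y
              ≡⟨ cong₂ (λ s t → u ++ rep s v₁ ++ rep t v₂ ++ v₂ ++ w) (ℕ.+-suc i p)
                   (trans (sym (ℕ.m+n∸m≡n (i ℕ.+ p) r)) (cong (_∸ (i ℕ.+ p)) eq)) ⟩
            u ++ rep (suc (i ℕ.+ p)) v₁ ++ rep (N ∸ (i ℕ.+ p)) v₂ ++ v₂ ++ w ∎
            where Y = rep r v₂ ++ v₂ ++ w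

        -- Here the raised block is a `v₂`, already one step above `v₁`, so `k` further steps lead
        -- to the digit `k + 1`.
        tower-in-run₂ : ∀ k σ → DigitAt (suc k) σ → ∀ j p r → suc j ℕ.+ p ℕ.+ r ≡ N →
          offset k (suc j ℕ.+ p) ℤ.+ tower j ≡
          value d (inserted (suc j) p σ 0 r)
        tower-in-run₂ k σ (∣σ∣ , σ≡) j p r eq = sym (begin
          value d (P ++ σ ++ Z)                   ≡⟨ value-replace P v₂ σ Z (+ k ℤ.* h) (trans ∣σ∣ ∣v₁∣≡∣v₂∣) σ≡v₂+ ⟩
          + (d ^ length P) ℤ.* (+ k ℤ.* h) ℤ.+ value d (P ++ v₂ ++ Z)
            ≡⟨ cong₂ (λ l z → + (d ^ l) ℤ.* (+ k ℤ.* h) ℤ.+ value d z)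
                 (length-prefix (suc j) p) reassociate ⟩
          offset k (suc j ℕ.+ p) ℤ.+ tower j      ∎)
          where
          open ≡-Reasoning
          P = u ++ rep (suc j) v₁ ++ rep p v₂
          Z = rep r v₂ ++ v₂ ++ w
          σ≡v₂+ : value d σ ≡ value d v₂ ℤ.+ + k ℤ.* h
          σ≡v₂+ = begin
            value d σ                              ≡⟨ σ≡ ⟩
            value d v₁ ℤ.+ + suc k ℤ.* h           ≡⟨ rearrange (value d v₁) (+ k) h ⟩
            value d v₁ ℤ.+ h ℤ.+ + k ℤ.* h         ≡⟨ cong (ℤ._+ + k ℤ.* h) v₂≡ ⟨
            value d v₂ ℤ.+ + k ℤ.* h               ∎
            where
            rearrange : ∀ v k h → v ℤ.+ (+ 1 ℤ.+ k) ℤ.* h ≡ v ℤ.+ h ℤ.+ k ℤ.* h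
            rearrange = solve-∀
          reassociate : P ++ v₂ ++ Z ≡ u ++ rep (suc j) v₁ ++ rep (N ∸ j) v₂ ++ v₂ ++ w
          reassociate = begin
            P ++ v₂ ++ Z                            ≡⟨ ++-assoc u _ _ ⟩
            u ++ (rep (suc j) v₁ ++ rep p v₂) ++ v₂ ++ Z ≡⟨ cong (u ++_) (++-assoc (rep (suc j) v₁) (rep p v₂) _) ⟩
            u ++ rep (suc j) v₁ ++ rep p v₂ ++ v₂ ++ rep r v₂ ++ Y
              ≡⟨ cong (λ t → u ++ rep (suc j) v₁ ++ rep p v₂ ++ t) (++-assoc v₂ (rep r v₂) Y) ⟨
            u ++ rep (suc j) v₁ ++ rep p v₂ ++ rep (suc r) v₂ ++ Y
              ≡⟨ cong (λ t → u ++ rep (suc j) v₁ ++ t) (++-assoc (rep p v₂) (rep (suc r) v₂) Y) ⟨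
            u ++ rep (suc j) v₁ ++ (rep p v₂ ++ rep (suc r) v₂) ++ Y
              ≡⟨ cong (λ t → u ++ rep (suc j) v₁ ++ t ++ Y) (rep-+ p (suc r) v₂) ⟨
            u ++ rep (suc j) v₁ ++ rep (p ℕ.+ suc r) v₂ ++ Y
              ≡⟨ cong (λ t → u ++ rep (suc j) v₁ ++ rep t v₂ ++ Y) count ⟩
            u ++ rep (suc j) v₁ ++ rep (N ∸ j) v₂ ++ Y ∎
            where
            Y = v₂ ++ w
            count : p ℕ.+ suc r ≡ N ∸ j
            count = begin
              p ℕ.+ suc r                    ≡⟨ ℕ.m+n∸m≡n j (p ℕ.+ suc r) ⟨
              j ℕ.+ (p ℕ.+ suc r) ∸ j        ≡⟨ cong (_∸ j) (shuffle j p r) ⟩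
              suc j ℕ.+ p ℕ.+ r ∸ j          ≡⟨ cong (_∸ j) eq ⟩
              N ∸ j                          ∎
              where
              shuffle : ∀ j p r → j ℕ.+ (p ℕ.+ suc r) ≡ suc j ℕ.+ p ℕ.+ r
              shuffle = solveℕ-∀

        -- If the first word had its value in `A` and the second had not, `offset k i + tower j`
        -- would lie in `A` exactly for `i ≤ j`, against stability. As `A` is decidable, this
        -- refutation suffices.
        extend : ∀ k σ σ′ → DigitAt k σ → DigitAt (suc k) σ′ →
          A (value d (u ++ σ ++ v₂ ++ w)) → A (value d (u ++ σ′ ++ v₂ ++ w))
        extend k σ σ′ σ-digit σ′-digit Aσ = decidable-stable (A? _) λ ¬Aσ′ →
          ¬ladder (offset k) tower
            (λ i p r eq → subst A (sym (tower-in-run₁ k σ σ-digit i p r eq))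
              (accepted⇒A (inserted i 0 σ p r)
                (trans (accepts-inserted i 0 σ p r) (A⇒accepted (u ++ σ ++ v₂ ++ w) Aσ))))
            (λ j p r eq A′ → ¬Aσ′ (accepted⇒A (u ++ σ′ ++ v₂ ++ w)
              (trans (sym (accepts-inserted (suc j) p σ′ 0 r))
                (A⇒accepted (inserted (suc j) p σ′ 0 r) (subst A (tower-in-run₂ k σ′ σ′-digit j p r eq) A′)))))

        module _ (K : ℕ) (room : ∣ value d v₁ ∣ ℕ.+ K ℕ.* ∣ h ∣ < d ^ ℓ) where

          digitAt : ∀ k → k ≤ K → ∃ (DigitAt k)
          digitAt k k≤K = represent ℓ (value d v₁ ℤ.+ + k ℤ.* h) (begin-strict
            ∣ value d v₁ ℤ.+ + k ℤ.* h ∣         ≤⟨ ℤ.∣i+j∣≤∣i∣+∣j∣ (value d v₁) _ ⟩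
            ∣ value d v₁ ∣ ℕ.+ ∣ + k ℤ.* h ∣     ≡⟨ cong (∣ value d v₁ ∣ ℕ.+_) (ℤ.abs-* (+ k) h) ⟩
            ∣ value d v₁ ∣ ℕ.+ k ℕ.* ∣ h ∣       ≤⟨ ℕ.+-monoʳ-≤ ∣ value d v₁ ∣ (ℕ.*-monoˡ-≤ ∣ h ∣ k≤K) ⟩
            ∣ value d v₁ ∣ ℕ.+ K ℕ.* ∣ h ∣       <⟨ room ⟩
            d ^ ℓ ∎)
            where open ℕ.≤-Reasoning

          base : ℤ
          base = value d (u ++ v₁ ++ v₂ ++ w)

          digit-value : ∀ k σ → DigitAt k σ →
            value d (u ++ σ ++ v₂ ++ w) ≡ base ℤ.+ + k ℤ.* (+ (d ^ length u) ℤ.* h)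
          digit-value k σ (∣σ∣ , σ≡) = trans (value-replace u v₁ σ (v₂ ++ w) (+ k ℤ.* h) ∣σ∣ σ≡)
            (rearrange (+ (d ^ length u)) (+ k) h base)
            where
            rearrange : ∀ D k h b → D ℤ.* (k ℤ.* h) ℤ.+ b ≡ b ℤ.+ k ℤ.* (D ℤ.* h)
            rearrange = solve-∀

          base∈A : A base
          base∈A = accepted⇒A (u ++ v₁ ++ v₂ ++ w) (begin
            final M (run M (start M) (u ++ v₁ ++ v₂ ++ w))      ≡⟨ cong (final M) (run-++ M (start M) u _) ⟩
            final M (run M (run M (start M) u) (v₁ ++ v₂ ++ w)) ≡⟨ cong (λ s → final M (run M s (v₁ ++ v₂ ++ w))) u-reaches ⟩
            final M (run M q (v₁ ++ v₂ ++ w))                   ≡⟨ cong (final M) (run-++ M q v₁ _) ⟩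
            final M (run M (run M q v₁) (v₂ ++ w))              ≡⟨ cong (λ s → final M (run M s (v₂ ++ w))) loop₁ ⟩
            final M (run M q (v₂ ++ w))                         ≡⟨ cong (final M) (run-++ M q v₂ _) ⟩
            final M (run M (run M q v₂) w)                      ≡⟨ cong (λ s → final M (run M s w)) loop₂ ⟩
            final M (run M q w)                                 ≡⟨ w-accepted ⟩
            true                                                ∎)
            where open ≡-Reasoning

          -- The induction starts at the digit `v₁` itself, whose word is accepted, and raises the
          -- block behind `u` by one step at a time; its weight `d ^ length u` enters the
          -- difference.
          progression : ∀ k → k ≤ K → A (base ℤ.+ + k ℤ.* (+ (d ^ length u) ℤ.* h))
          progression zero    _   = subst A (sym (ℤ.+-identityʳ base)) base∈A
          progression (suc k) k<K =
            let σ  , σ-digit  = digitAt k (ℕ.<⇒≤ k<K)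
                σ′ , σ′-digit = digitAt (suc k) k<K
            in subst A (digit-value (suc k) σ′ σ′-digit)
                 (extend k σ σ′ σ-digit σ′-digit
                   (subst A (sym (digit-value k σ σ-digit)) (progression k (ℕ.<⇒≤ k<K))))

      -- Loops with the required absorption

      module _ (P : Pump M) where
        open Pump P

        private
          -- `E`-th powers act idempotently, which gives `v₂ ++ v₂ ∼ v₂`. Moreover `v₂` begins with
          -- `s`, the `E`-th power of `x`, and `v₁` is a power of `x` whose exponent is a multiple
          -- of `E`, so `s` absorbs `v₁`.
          E = nStates M !
          s = rep E x
          v₁ = rep E (s ++ x)
          v₂ = rep E (s ++ y)
          h = value d v₂ ℤ.- value d v₁

        ∣sx∣≡∣sy∣ : length (s ++ x) ≡ length (s ++ y)
        ∣sx∣≡∣sy∣ = trans (length-++ s) (trans (cong (length s ℕ.+_) ∣x∣≡∣y∣) (sym (length-++ s)))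

        ∣v₁∣≡∣v₂∣ : length v₁ ≡ length v₂
        ∣v₁∣≡∣v₂∣ = trans (length-rep E (s ++ x)) (trans (cong (E ℕ.*_) ∣sx∣≡∣sy∣) (sym (length-rep E (s ++ y))))

        v₁≡rep : v₁ ≡ rep (E ℕ.* suc E) x
        v₁≡rep = trans (cong (rep E) (rep-comm E x)) (rep-* E (suc E) x)

        -- As `E` is positive, `h` is a positive multiple of the difference of the values of `y` and
        -- `x`, which differ even in absolute value.
        h≢0 : h ≢ + 0
        h≢0 h≡0 with E in eq | ℕ.1≤n! (nStates M)
        ... | suc E′ | _ with g , v₂≡ ← value-rep-difference (rep (suc E′) x) x y ∣x∣≡∣y∣ E′ =
          ℕ.<⇒≢ x<y (cong ∣_∣ (sym (ℤ.i-j≡0⇒i≡j (value d y) (value d x) (product≡0 (begin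
            + suc g ℤ.* c                          ≡⟨ rearrange (value d V₁) (+ suc g ℤ.* c) ⟩
            value d V₁ ℤ.+ + suc g ℤ.* c ℤ.- value d V₁  ≡⟨ cong (ℤ._- value d V₁) v₂≡ ⟨
            value d (rep (suc E′) (rep (suc E′) x ++ y)) ℤ.- value d V₁ ≡⟨ h≡0 ⟩
            + 0                                    ∎)))))
          where
          open ≡-Reasoning
          c = value d y ℤ.- value d x
          V₁ = rep (suc E′) (rep (suc E′) x ++ x)
          rearrange : ∀ v t → t ≡ v ℤ.+ t ℤ.- v
          rearrange = solve-∀
          product≡0 : + suc g ℤ.* c ≡ + 0 → c ≡ + 0
          product≡0 p with ℤ.i*j≡0⇒i≡0∨j≡0 (+ suc g) p
          ... | inj₂ c≡0 = c≡0

        v₂-absorbed : v₂ ++ v₂ ∼ v₂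
        v₂-absorbed q = begin
          run M q (v₂ ++ v₂)                       ≡⟨ cong (run M q) (rep-+ E E (s ++ y)) ⟨
          run M q (rep (E ℕ.+ E) (s ++ y))         ≡⟨ cong (λ k → run M q (rep (k ℕ.+ E) (s ++ y))) (ℕ.*-identityˡ E) ⟨
          run M q (rep (1 ℕ.* E ℕ.+ E) (s ++ y))   ≡⟨ rep-factorial M 1 (s ++ y) q ⟩
          run M q v₂                               ∎
          where open ≡-Reasoning

        v₁++s∼s : v₁ ++ s ∼ s
        v₁++s∼s q = begin
          run M q (v₁ ++ s)
            ≡⟨ cong (λ v → run M q (v ++ s)) (trans v₁≡rep (cong (λ k → rep k x) (ℕ.*-comm E (suc E)))) ⟩
          run M q (rep (suc E ℕ.* E) x ++ s)    ≡⟨ cong (run M q) (rep-+ (suc E ℕ.* E) E x) ⟨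
          run M q (rep (suc E ℕ.* E ℕ.+ E) x)   ≡⟨ rep-factorial M (suc E) x q ⟩
          run M q s                             ∎
          where open ≡-Reasoning

        v₁-absorbed : v₁ ++ v₂ ∼ v₂
        v₁-absorbed q = subst (λ t → run M q (v₁ ++ t) ≡ run M q t) (sym (proj₂ starts-with-s)) (begin
          run M q (v₁ ++ s ++ t)      ≡⟨ cong (run M q) (++-assoc v₁ s t) ⟨
          run M q ((v₁ ++ s) ++ t)    ≡⟨ ≈-++ M (v₁ ++ s) s t t v₁++s∼s (λ _ → refl) q ⟩
          run M q (s ++ t)            ∎)
          where
          open ≡-Reasoning
          starts-with-s : ∃ λ t → v₂ ≡ s ++ t
          starts-with-s with E | ℕ.1≤n! (nStates M)
          ... | suc E′ | _ = y ++ rep E′ (rep (suc E′) x ++ y) , ++-assoc (rep (suc E′) x) y _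
          t = proj₁ starts-with-s

        loop-s++ : ∀ z → run M q z ≡ q → run M q (s ++ z) ≡ q
        loop-s++ z loop = trans (run-++ M q s z) (trans (cong (λ p → run M p z) (run-rep-loop M E x loop-x)) loop)

        loop-v₁ : run M q v₁ ≡ q
        loop-v₁ = run-rep-loop M E (s ++ x) (loop-s++ x loop-x)

        loop-v₂ : run M q v₂ ≡ q
        loop-v₂ = run-rep-loop M E (s ++ y) (loop-s++ y loop-y)

        2+∣x∣≤ : 2 ℕ.+ ∣ value d x ∣ ≤ d ^ length x
        2+∣x∣≤ = ℕ.≤-trans (s≤s x<y) (subst (λ l → ∣ value d y ∣ < d ^ l) (sym ∣x∣≡∣y∣) (∣value∣<d^length y))

        difference : ℤ
        difference = + (d ^ length u) ℤ.* h

        difference≢0 : difference ≢ + 0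
        difference≢0 eq with ℤ.i*j≡0⇒i≡0∨j≡0 (+ (d ^ length u)) eq
        ... | inj₁ p = ℕ.<⇒≢ (ℕ.m^n>0 d (length u)) (sym (ℤ.+-injective p))
        ... | inj₂ p = h≢0 p

        -- Padding both loops by t copies of v₁ keeps their difference h but
        -- makes room for K multiples of it.
        progressions : ∀ K → ∃ λ b → ∀ k → k ≤ K → A (b ℤ.+ + k ℤ.* difference)
        progressions K = value d (u ++ V₁ ++ V₂ ++ w) , progression q u V₁ V₂ w h
          (trans (length-++ v₁) (trans (cong (ℕ._+ length (rep t v₁)) ∣v₁∣≡∣v₂∣) (sym (length-++ v₂))))
          V₂≡ u-reaches
          (run-rep-loop M (suc t) v₁ loop-v₁)
          (trans (run-++ M q v₂ (rep t v₁))
            (trans (cong (λ p → run M p (rep t v₁)) loop-v₂) (run-rep-loop M t v₁ loop-v₁)))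
          w-accepted V₁-absorbed V₂-absorbed K room
          where
          -- `V₁` is a power of `x` with exponent at least `suc t`, so its slack below
          -- `d ^ length V₁` exceeds `K * ∣ h ∣`.
          t = K ℕ.* ∣ h ∣
          V₁ = v₁ ++ rep t v₁
          V₂ = v₂ ++ rep t v₁

          V₂≡ : value d V₂ ≡ value d V₁ ℤ.+ h
          V₂≡ = begin
            value d V₂  ≡⟨ value-replace [] v₁ v₂ (rep t v₁) h (sym ∣v₁∣≡∣v₂∣) (rearrange (value d v₂) (value d v₁)) ⟩
            + 1 ℤ.* h ℤ.+ value d V₁  ≡⟨ swap h (value d V₁) ⟩
            value d V₁ ℤ.+ h ∎
            where
            open ≡-Reasoning
            rearrange : ∀ a b → a ≡ b ℤ.+ (a ℤ.- b)
            rearrange = solve-∀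
            swap : ∀ a b → + 1 ℤ.* a ℤ.+ b ≡ b ℤ.+ a
            swap = solve-∀

          -- The padding is placed behind `v₂`: in a product the padding of the first factor then
          -- meets the `v₂` of the second, which absorbs it.
          V₁-absorbed : V₁ ++ V₂ ∼ V₂
          V₁-absorbed r = begin
            run M r (V₁ ++ v₂ ++ rep t v₁)     ≡⟨ cong (run M r) (++-assoc V₁ v₂ (rep t v₁)) ⟨
            run M r ((V₁ ++ v₂) ++ rep t v₁)
              ≡⟨ ≈-++ M (V₁ ++ v₂) v₂ (rep t v₁) (rep t v₁) (rep-absorbed M (suc t) v₁ v₂ v₁-absorbed) (λ _ → refl) r ⟩
            run M r V₂ ∎
            where open ≡-Reasoning

          V₂-absorbed : V₂ ++ V₂ ∼ V₂
          V₂-absorbed r = begin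
            run M r ((v₂ ++ rep t v₁) ++ v₂ ++ rep t v₁) ≡⟨ cong (run M r) (++-assoc v₂ (rep t v₁) _) ⟩
            run M r (v₂ ++ rep t v₁ ++ v₂ ++ rep t v₁)
              ≡⟨ cong (λ z → run M r (v₂ ++ z)) (++-assoc (rep t v₁) v₂ (rep t v₁)) ⟨
            run M r (v₂ ++ (rep t v₁ ++ v₂) ++ rep t v₁)
              ≡⟨ ≈-++ M v₂ v₂ _ V₂ (λ _ → refl)
                   (≈-++ M (rep t v₁ ++ v₂) v₂ (rep t v₁) (rep t v₁) (rep-absorbed M t v₁ v₂ v₁-absorbed) (λ _ → refl)) r ⟩
            run M r (v₂ ++ v₂ ++ rep t v₁)     ≡⟨ cong (run M r) (++-assoc v₂ v₂ (rep t v₁)) ⟨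
            run M r ((v₂ ++ v₂) ++ rep t v₁)
              ≡⟨ ≈-++ M (v₂ ++ v₂) v₂ (rep t v₁) (rep t v₁) v₂-absorbed (λ _ → refl) r ⟩
            run M r V₂ ∎
            where open ≡-Reasoning

          V₁≡rep : V₁ ≡ rep (suc t ℕ.* (E ℕ.* suc E)) x
          V₁≡rep = trans (cong (rep (suc t)) v₁≡rep) (rep-* (suc t) (E ℕ.* suc E) x)

          room : ∣ value d V₁ ∣ ℕ.+ K ℕ.* ∣ h ∣ < d ^ length V₁
          room = begin-strict
            ∣ value d V₁ ∣ ℕ.+ t
              ≤⟨ ℕ.+-monoʳ-≤ ∣ value d V₁ ∣ (ℕ.≤-trans (ℕ.n≤1+n t) (ℕ.m≤m*n (suc t) (E ℕ.* suc E))) ⟩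
            ∣ value d V₁ ∣ ℕ.+ copies
              <⟨ subst (λ v → ∣ value d v ∣ ℕ.+ copies < d ^ length v) (sym V₁≡rep) (∣value-rep∣ x 2+∣x∣≤ copies) ⟩
            d ^ length V₁ ∎
            where
            open ℕ.≤-Reasoning
            copies = suc t ℕ.* (E ℕ.* suc E)
            instance _ = ℕ.m*n≢0 E (suc E) {{nStates M ℕ.!≢0}}

-- Long gaps and genericity

bounded : (f : Fin n → ℤ) → ∃ λ b → ∀ i → ∣ f i ∣ ≤ b
bounded {zero}  f = 0 , λ ()
bounded {suc n} f with b , f≤b ← bounded (f ∘ suc) = ∣ f zero ∣ ℕ.+ b , λ where
  zero    → ℕ.m≤m+n _ b
  (suc i) → ℕ.≤-trans (f≤b i) (ℕ.m≤n+m b _)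

shift-nonnegative : ∀ b z → ∣ z ∣ ≤ b → ∃ λ s → s ≤ b ℕ.+ b × + b ℤ.+ z ≡ + s
shift-nonnegative b (+ n)    n≤b = b ℕ.+ n , ℕ.+-monoʳ-≤ b n≤b , refl
shift-nonnegative b -[1+ n ] n≤b = b ∸ suc n , ℕ.≤-trans (ℕ.m∸n≤m b (suc n)) (ℕ.m≤m+n b b) , ℤ.⊖-≥ n≤b

module Gaps (e : ℕ) (2≤d : 2 ≤ suc e) (A : ℤ → Set) (M : DFA (suc e ℕ.+ e))
  (rec : Recognises M (λ w → A (value (suc e) w))) where

  open Base e
  open Progressions e
  open Recognised 2≤d A M rec

  module _ (k : ℕ) where

    private
      L = d ^ k
      States = Vec (Fin (nStates M)) L

      low : ∀ s → ∃ λ w → length w ≡ k × value d w ≡ + toℕ s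
      low s = represent k (+ toℕ s) (Fin.toℕ<n {L} s)

      lowWord : Fin L → Word
      lowWord s = proj₁ (low s)

      step : States → Letter → States
      step v a = Vec.map (λ q → δ M q a) v

      lookup-foldl : ∀ v w s → Vec.lookup (foldl step v w) s ≡ run M (Vec.lookup v s) w
      lookup-foldl v []      s = refl
      lookup-foldl v (a ∷ w) s = trans (lookup-foldl (step v a) w s)
        (cong (λ q → run M q w) (Vec.lookup-map s (λ q → δ M q a) v))

      initial : States
      initial = tabulate λ s → run M (start M) (lowWord s)

      final-low : ∀ w s → final M (Vec.lookup (foldl step initial w) s) ≡ accepts M (lowWord s ++ w)
      final-low w s = cong (final M) (begin
        Vec.lookup (foldl step initial w) s     ≡⟨ lookup-foldl initial w s ⟩
        run M (Vec.lookup initial s) w          ≡⟨ cong (λ q → run M q w) (Vec.lookup∘tabulate _ s) ⟩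
        run M (run M (start M) (lowWord s)) w   ≡⟨ run-++ M (start M) (lowWord s) w ⟨
        run M (start M) (lowWord s ++ w)        ∎)
        where open ≡-Reasoning

      value-low : ∀ s w → value d (lowWord s ++ w) ≡ + L ℤ.* value d w ℤ.+ + toℕ s
      value-low s w = begin
        value d (lowWord s ++ w)   ≡⟨ value-++ (lowWord s) w ⟩
        value d (lowWord s) ℤ.+ + (d ^ length (lowWord s)) ℤ.* value d w
          ≡⟨ cong₂ (λ v l → v ℤ.+ + (d ^ l) ℤ.* value d w) (proj₂ (proj₂ (low s))) (proj₁ (proj₂ (low s))) ⟩
        + toℕ s ℤ.+ + L ℤ.* value d w  ≡⟨ ℤ.+-comm (+ toℕ s) (+ L ℤ.* value d w) ⟩
        + L ℤ.* value d w ℤ.+ + toℕ s  ∎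
        where open ≡-Reasoning

      Empty : States → Set
      Empty v = ∀ s → final M (Vec.lookup v s) ≡ false

    -- As low digits are read first, the numbers `L * x + s` with `s < L` are written by the words
    -- `lowWord s` with a common continuation `w` of value `x`. A vector of `L` states follows all
    -- these runs at once, and a block that misses `A` is a reachable vector of nonfinal states.
    emptyBlock? : (∀ x → ∃ λ s → s < L × A (+ L ℤ.* x ℤ.+ + s)) ⊎
                  (∃ λ x → ∀ s → s < L → ¬ A (+ L ℤ.* x ℤ.+ + s))
    emptyBlock?
      with Reachability.reach? step any? vecCode (λ {v} {w} → vecCode-injective v w)
             {Empty} (λ v → all? λ s → final M (Vec.lookup v s) ≟ᵇ false) initial
    ... | yes (w , empty) = inj₂ (value d w , λ s s<L As →
            contradiction (trans (sym (empty (fromℕ< s<L))) (trans (final-low w (fromℕ< s<L))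
              (A⇒accepted (lowWord (fromℕ< s<L) ++ w)
                (subst A (sym (trans (value-low (fromℕ< s<L) w)
                   (cong (λ t → + L ℤ.* value d w ℤ.+ + t) (Fin.toℕ-fromℕ< s<L)))) As)))) λ ())
    ... | no ¬empty = inj₁ nonempty
      where
      nonempty : ∀ x → ∃ λ s → s < L × A (+ L ℤ.* x ℤ.+ + s)
      nonempty x with any? {L} (λ s → A? (+ L ℤ.* x ℤ.+ + toℕ s))
      ... | yes (s , As) = toℕ s , Fin.toℕ<n s , As
      ... | no none with w , refl ← wordOf x = contradiction (w , empty) ¬empty
        where
        empty : Empty (foldl step initial w)
        empty s with final M (Vec.lookup (foldl step initial w) s) in eq
        ... | false = refl
        ... | true  = contradiction (s , subst A (value-low s w)
                        (accepted⇒A (lowWord s ++ w) (trans (sym (final-low w s)) eq))) none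

    -- The remainder `r` of `z` and the place `s` of an element of `A` in the same block are both
    -- below `L`, so the finitely many differences `r - s` suffice as translations.
    blocks⇒generic : (∀ x → ∃ λ s → s < L × A (+ L ℤ.* x ℤ.+ + s)) → Generic A
    blocks⇒generic hit = cartesianProductWith (λ r s → + r ℤ.- + s) (upTo L) (upTo L) , λ z →
      let r = z ℤ.%ℕ L; x = z ℤ./ℕ L; s , s<L , As = hit x in
      + r ℤ.- + s , ∈-cartesianProductWith⁺ _ (∈-upTo⁺ (n%ℕd<d z L)) (∈-upTo⁺ s<L) ,
      subst A (trans (rearrange (+ r) (+ s) x (+ L)) (cong (ℤ._- (+ r ℤ.- + s)) (sym (a≡a%ℕn+[a/ℕn]*n z L)))) As
      where
      instance _ = ℕ.m^n≢0 d k
      rearrange : ∀ r s x l → l ℤ.* x ℤ.+ s ≡ r ℤ.+ x ℤ.* l ℤ.- (r ℤ.- s)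
      rearrange = solve-∀

  generic-or-gap : ∀ b → Generic A ⊎ ∃ λ z → ∀ c → ∣ c ∣ ≤ b → ¬ A (z ℤ.+ c)
  -- A block of length `d ^ (b + b)`, which exceeds `b + b`, contains the whole interval of radius
  -- `b` around its element number `b`, counted from 0.
  generic-or-gap b with emptyBlock? (b ℕ.+ b)
  ... | inj₁ hit = inj₁ (blocks⇒generic (b ℕ.+ b) hit)
  ... | inj₂ (x , empty) = inj₂ (+ L ℤ.* x ℤ.+ + b , λ c c≤b Ac →
    let s , s≤2b , b+c≡s = shift-nonnegative b c c≤b in
    empty s (ℕ.≤-<-trans s≤2b (n<d^n 2≤d (b ℕ.+ b)))
      (subst A (trans (ℤ.+-assoc (+ L ℤ.* x) (+ b) c) (cong (λ t → + L ℤ.* x ℤ.+ t) b+c≡s)) Ac))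
    where L = d ^ (b ℕ.+ b)

  -- Ladders from gaps and progressions

  module _ (h : ℤ) .{{_ : ℤ.NonZero h}}
    (progressions : ∀ K → ∃ λ b → ∀ k → k ≤ K → A (b ℤ.+ + k ℤ.* h)) where

    -- The `a i` enter multiplied by `h`, so that one `b` can move all of them into a progression of
    -- difference `h`. New entries are put in front, which is why membership goes with `j ≤ i`.
    Ladder : ℕ → Set
    Ladder n = ∃₂ λ (a b : Fin n → ℤ) → ∀ i j →
      (j Fin.≤ i → A (a i ℤ.* h ℤ.+ b j)) × (i Fin.< j → ¬ A (a i ℤ.* h ℤ.+ b j))

    ladder-suc : Ladder n → Generic A ⊎ Ladder (suc n)
    -- In the radius, `β` accounts for the earlier `b j`, and `∣ h ∣` for rounding `z` to a multiple
    -- of `h`.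
    ladder-suc (a , b , ladder) with β , b≤β ← bounded b with generic-or-gap (β ℕ.+ ∣ h ∣)
    ... | inj₁ generic = inj₁ generic
    -- The new `a` is fixed before the new `b`, which has to serve it as well. The new `b` is term
    -- number `α` of a progression with `α + α + 1` terms; adding any `a′ i * h` moves it by at most
    -- `α` terms either way.
    ... | inj₂ (z , gap) with α , a≤α ← bounded ((z ℤ./ h) ◂ a)
      with p , Ap ← progressions (α ℕ.+ α) = inj₂ (a′ , b′ , λ i j → below i j , above i j)
      where
      r = z ℤ.% h
      a′ = (z ℤ./ h) ◂ a
      b′ = (p ℤ.+ + α ℤ.* h) ◂ b

      in-progression : ∀ i → A (a′ i ℤ.* h ℤ.+ (p ℤ.+ + α ℤ.* h))
      in-progression i with k , k≤2α , α+a≡k ← shift-nonnegative α (a′ i) (a≤α i) =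
        subst A (trans (cong (λ t → p ℤ.+ t ℤ.* h) (sym α+a≡k)) (rearrange p (+ α) (a′ i) h)) (Ap k k≤2α)
        where
        rearrange : ∀ p α a h → p ℤ.+ (α ℤ.+ a) ℤ.* h ≡ a ℤ.* h ℤ.+ (p ℤ.+ α ℤ.* h)
        rearrange = solve-∀

      in-gap : ∀ j → ¬ A ((z ℤ./ h) ℤ.* h ℤ.+ b j)
      in-gap j Aj = gap (b j ℤ.- + r)
        (ℕ.≤-trans (ℤ.∣i-j∣≤∣i∣+∣j∣ (b j) (+ r)) (ℕ.+-mono-≤ (b≤β j) (ℕ.<⇒≤ (n%d<d z h))))
        (subst A (trans (rearrange ((z ℤ./ h) ℤ.* h) (+ r) (b j))
                        (cong (ℤ._+ (b j ℤ.- + r)) (sym (a≡a%n+[a/n]*n z h)))) Aj)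
        where
        rearrange : ∀ x r b → x ℤ.+ b ≡ r ℤ.+ x ℤ.+ (b ℤ.- r)
        rearrange = solve-∀

      below : ∀ i j → j Fin.≤ i → A (a′ i ℤ.* h ℤ.+ b′ j)
      below i       zero    _         = in-progression i
      below (suc i) (suc j) (s≤s j≤i) = proj₁ (ladder i j) j≤i

      above : ∀ i j → i Fin.< j → ¬ A (a′ i ℤ.* h ℤ.+ b′ j)
      above zero    (suc j) _         = in-gap j
      above (suc i) (suc j) (s≤s i<j) = proj₂ (ladder i j) i<j

    generic-or-ladder : ∀ n → Generic A ⊎ Ladder n
    generic-or-ladder zero = inj₂ ((λ ()) , (λ ()) , λ ())
    generic-or-ladder (suc n) with generic-or-ladder n
    ... | inj₁ generic = inj₁ generic
    ... | inj₂ ladder  = ladder-suc ladder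

    stable⇒generic : Stable A → Generic A
    stable⇒generic (N , stable) with generic-or-ladder (suc N)
    ... | inj₁ generic = generic
    -- The two families exchange their roles here, which turns `j ≤ i` into the order demanded by
    -- stability.
    ... | inj₂ (a , b , ladder) = contradiction
      (λ i j → mk⇔
        (λ Aij → ℕ.≮⇒≥ λ j<i → proj₂ (ladder j i) j<i (subst A (ℤ.+-comm (b i) (a j ℤ.* h)) Aij))
        (λ i≤j → subst A (ℤ.+-comm (a j ℤ.* h) (b i)) (proj₁ (ladder j i) i≤j)))
      (stable b (λ j → a j ℤ.* h))

theorem4p2 : (d : ℕ) .{{_ : NonZero d}} → 2 ≤ d → (A : ℤ → Set) →
    Automatic d A → ¬ SparseSet d A → Stable A → Generic A
theorem4p2 zero    ()
theorem4p2 (suc e) 2≤d A (M , recognises) ¬sparse stable@(_ , noLadder) =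
  stable⇒generic (difference noLadder pump) {{ℤ.≢-nonZero (difference≢0 noLadder pump)}}
    (progressions noLadder pump) stable
  where
  open Base e
  open Progressions e
  open Recognised 2≤d A M recognises
  open Gaps e 2≤d A M recognises

  pump : Pump M
  pump = doubleLoop⇒pump M
    (¬sparse⇒doubleLoop (canonicalDFA M) (canonicalDFA-recognises 2≤d A M recognises) ¬sparse)
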